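{- For any integer $n\ge 0$, we have \[\mathrm{pod}(5n+2)\equiv 2(-1)^{n}r_{3}(8n+3) \pmod{5}.\]
   Context: For an integer $n\ge 0$, $\mathrm{pod}(n)$ denotes the number of partitions of $n$ in which the odd parts are distinct (even parts may repeat); equivalently $\sum_{n\ge 0}\mathrm{pod}(n)q^n=\prod_{i\ge 1}\frac{1+q^{2i-1}}{1-q^{2i}}$. For nonnegative integers $k,n$, $r_k(n)$ denotes the number of representations of $n$ as a sum of $k$ squares, i.e. the number of tuples $(x_1,\dots,x_k)\in\mathbb{Z}^k$ with $x_1^2+\cdots+x_k^2=n$ (order and signs count). -}

module Defs where

open import Data.Empty using (⊥)
open import Data.Integer as ℤ using (ℤ; +_; -[1+_]; 0ℤ; ∣_∣)
import Data.Integer.Divisibility.Signed as ℤDiv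
import Data.Integer.Properties as ℤP
open import Data.List
  using (List; []; _∷_; _++_; map; filter; length; upTo; cartesianProductWith)
open import Data.List.Membership.Propositional using (_∈_)
open import Data.List.Membership.Propositional.Properties
  using (∈-map⁺; ∈-map⁻; ∈-++⁺ˡ; ∈-++⁺ʳ; ∈-upTo⁺; ∈-filter⁺; ∈-filter⁻
        ; ∈-cartesianProductWith⁺; ∈-cartesianProductWith⁻)
import Data.List.Properties as LP
open import Data.List.Relation.Unary.All as All using (All; []; _∷_)
open import Data.List.Relation.Unary.AllPairs using ([]; _∷_)
open import Data.List.Relation.Unary.Any using (here; there)
open import Data.List.Relation.Unary.Linked using (Linked; linked?)
open import Data.List.Relation.Unary.Unique.Propositional using (Unique)
import Data.List.Relation.Unary.Unique.Propositional.Properties as Uniq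
open import Data.Nat as ℕ using (ℕ; zero; suc; _+_; _*_; _≤_; _≥_; _<_; z≤n; s≤s)
open import Data.List.Relation.Unary.Unique.DecPropositional ℕ._≟_ using (unique?)
open import Data.Nat.Divisibility using (_∣?_)
open import Data.Nat.ListAction using (sum)
import Data.Nat.Properties as ℕP
open import Data.Product using (_×_; _,_; ∃; proj₂)
open import Data.Vec using (Vec; []; _∷_)
import Data.Vec.Properties as VP
open import Function.Bundles using (_⇔_; mk⇔)
open import Relation.Binary.PropositionalEquality
  using (_≡_; refl; sym; trans; cong₂)
open import Relation.Nullary using (Dec; ¬_; ¬?)
open import Relation.Nullary.Decidable using (_×-dec_)

infix 4 _≡_[mod_]

_≡_[mod_] : ℤ → ℤ → ℕ → Set
a ≡ b [mod m ] = + m ℤDiv.∣ (a ℤ.- b)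

IsPartition : ℕ → List ℕ → Set
IsPartition n ps = All (0 <_) ps × Linked _≥_ ps × sum ps ≡ n

isPartition? : ∀ n ps → Dec (IsPartition n ps)
isPartition? n ps =
  All.all? (0 ℕ.<?_) ps ×-dec linked? ℕ._≥?_ ps ×-dec (sum ps ℕ.≟ n)

oddParts : List ℕ → List ℕ
oddParts = filter (λ p → ¬? (2 ∣? p))

IsPODPartition : ℕ → List ℕ → Set
IsPODPartition n ps = IsPartition n ps × Unique (oddParts ps)

isPODPartition? : ∀ n ps → Dec (IsPODPartition n ps)
isPODPartition? n ps = isPartition? n ps ×-dec unique? (oddParts ps)

listsUpTo : ∀ {A : Set} → List A → ℕ → List (List A)
listsUpTo xs zero    = [] ∷ []
listsUpTo xs (suc l) = [] ∷ cartesianProductWith _∷_ xs (listsUpTo xs l)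

-- The search box (at most n parts, each in 1..n) loses nothing:
-- see ∈-podPartitions.
podPartitions : ℕ → List (List ℕ)
podPartitions n = filter (isPODPartition? n) (listsUpTo (map suc (upTo n)) n)

pod : ℕ → ℕ
pod n = length (podPartitions n)

sumOfSquares : ∀ {k} → Vec ℤ k → ℤ
sumOfSquares []       = 0ℤ
sumOfSquares (x ∷ xs) = x ℤ.* x ℤ.+ sumOfSquares xs

symRange : ℕ → List ℤ
symRange n = map +_ (upTo (suc n)) ++ map -[1+_] (upTo n)

vecsOver : ∀ {A : Set} → List A → ∀ k → List (Vec A k)
vecsOver xs zero    = [] ∷ []
vecsOver xs (suc k) = cartesianProductWith _∷_ xs (vecsOver xs k)

-- The search box [-n , n]ᵏ loses nothing: see ∈-representations.
representations : ∀ k → ℕ → List (Vec ℤ k)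
representations k n =
  filter (λ v → sumOfSquares v ℤ.≟ + n) (vecsOver (symRange n) k)

r : ℕ → ℕ → ℕ
r k n = length (representations k n)

-- podPartitions and representations list exactly the objects to be counted,
-- each once, so that their lengths are the intended cardinalities.

private
  listsUpTo-complete : ∀ {A : Set} {xs : List A} {l} {ys : List A} →
    length ys ≤ l → All (_∈ xs) ys → ys ∈ listsUpTo xs l
  listsUpTo-complete {l = zero}  z≤n     []       = here refl
  listsUpTo-complete {l = suc l} z≤n     []       = here refl
  listsUpTo-complete {l = suc l} (s≤s p) (q ∷ qs) =
    there (∈-cartesianProductWith⁺ _∷_ q (listsUpTo-complete p qs))

  listsUpTo-unique : ∀ {A : Set} {xs : List A} → Unique xs → ∀ l →
    Unique (listsUpTo xs l)
  listsUpTo-unique u zero = [] ∷ []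
  listsUpTo-unique {xs = xs} u (suc l) =
    All.tabulate (λ y∈ → λ { refl → []∉ y∈ })
    ∷ Uniq.cartesianProductWith⁺ _∷_ LP.∷-injective u (listsUpTo-unique u l)
    where
    []∉ : ¬ ([] ∈ cartesianProductWith _∷_ xs (listsUpTo xs l))
    []∉ m with ∈-cartesianProductWith⁻ _∷_ xs (listsUpTo xs l) m
    ... | _ , _ , _ , _ , ()

  ∈-parts : ∀ {n p} → 0 < p → p ≤ n → p ∈ map suc (upTo n)
  ∈-parts {p = suc p} _ p≤n = ∈-map⁺ suc (∈-upTo⁺ p≤n)

  length≤sum : ∀ {ps} → All (0 <_) ps → length ps ≤ sum ps
  length≤sum []       = z≤n
  length≤sum (q ∷ qs) = ℕP.+-mono-≤ q (length≤sum qs)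

  parts-in-range : ∀ {n} ps → All (0 <_) ps → sum ps ≤ n →
    All (_∈ map suc (upTo n)) ps
  parts-in-range []       []       _  = []
  parts-in-range (p ∷ ps) (q ∷ qs) le =
    ∈-parts q (ℕP.≤-trans (ℕP.m≤m+n p (sum ps)) le)
    ∷ parts-in-range ps qs (ℕP.≤-trans (ℕP.m≤n+m (sum ps) p) le)

∈-podPartitions : ∀ n ps → ps ∈ podPartitions n ⇔ IsPODPartition n ps
∈-podPartitions n ps = mk⇔
  (λ m → proj₂ (∈-filter⁻ (isPODPartition? n)
                 {xs = listsUpTo (map suc (upTo n)) n} m))
  complete
  where
  complete : IsPODPartition n ps → ps ∈ podPartitions n
  complete h@((pos , _ , refl) , _) =
    ∈-filter⁺ (isPODPartition? n)
      (listsUpTo-complete (length≤sum pos) (parts-in-range ps pos ℕP.≤-refl)) h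

podPartitions-unique : ∀ n → Unique (podPartitions n)
podPartitions-unique n = Uniq.filter⁺ (isPODPartition? n)
  (listsUpTo-unique (Uniq.map⁺ ℕP.suc-injective (Uniq.upTo⁺ n)) n)

private
  symRange-complete : ∀ {n} x → ∣ x ∣ ≤ n → x ∈ symRange n
  symRange-complete     (+ m)    le = ∈-++⁺ˡ (∈-map⁺ +_ (∈-upTo⁺ (s≤s le)))
  symRange-complete {n} -[1+ m ] le =
    ∈-++⁺ʳ (map +_ (upTo (suc n))) (∈-map⁺ -[1+_] (∈-upTo⁺ le))

  symRange-unique : ∀ n → Unique (symRange n)
  symRange-unique n = Uniq.++⁺
    (Uniq.map⁺ ℤP.+-injective (Uniq.upTo⁺ (suc n)))
    (Uniq.map⁺ ℤP.-[1+-injective (Uniq.upTo⁺ n))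
    λ { (a , b) → disjoint (∈-map⁻ +_ a) (∈-map⁻ -[1+_] b) }
    where
    disjoint : ∀ {x} → ∃ (λ i → i ∈ upTo (suc n) × x ≡ + i) →
                       ∃ (λ i → i ∈ upTo n × x ≡ -[1+ i ]) → ⊥
    disjoint (_ , _ , refl) (_ , _ , ())

  vecsOver-unique : ∀ {A : Set} {xs : List A} → Unique xs → ∀ k →
    Unique (vecsOver xs k)
  vecsOver-unique u zero    = [] ∷ []
  vecsOver-unique u (suc k) =
    Uniq.cartesianProductWith⁺ _∷_ VP.∷-injective u (vecsOver-unique u k)

  normSum : ∀ {k} → Vec ℤ k → ℕ
  normSum []       = 0
  normSum (x ∷ xs) = ∣ x ∣ * ∣ x ∣ + normSum xs

  square-abs : ∀ x → x ℤ.* x ≡ + (∣ x ∣ * ∣ x ∣)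
  square-abs (+ m)    = ℤP.+◃n≡+n (m * m)
  square-abs -[1+ m ] = refl

  sumOfSquares-norm : ∀ {k} (v : Vec ℤ k) → sumOfSquares v ≡ + normSum v
  sumOfSquares-norm []       = refl
  sumOfSquares-norm (x ∷ xs) =
    cong₂ ℤ._+_ (square-abs x) (sumOfSquares-norm xs)

  m≤m*m : ∀ m → m ≤ m * m
  m≤m*m zero    = z≤n
  m≤m*m (suc m) = ℕP.m≤m*n (suc m) (suc m)

  vecsOver-complete : ∀ {k n} (v : Vec ℤ k) → normSum v ≤ n →
    v ∈ vecsOver (symRange n) k
  vecsOver-complete []       _  = here refl
  vecsOver-complete (x ∷ xs) le = ∈-cartesianProductWith⁺ _∷_
    (symRange-complete x
      (ℕP.≤-trans (m≤m*m ∣ x ∣) (ℕP.≤-trans (ℕP.m≤m+n _ (normSum xs)) le)))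
    (vecsOver-complete xs (ℕP.≤-trans (ℕP.m≤n+m (normSum xs) _) le))

∈-representations : ∀ k n (v : Vec ℤ k) →
  v ∈ representations k n ⇔ sumOfSquares v ≡ + n
∈-representations k n v = mk⇔
  (λ m → proj₂ (∈-filter⁻ (λ v → sumOfSquares v ℤ.≟ + n)
                 {xs = vecsOver (symRange n) k} m))
  (λ h → ∈-filter⁺ (λ v → sumOfSquares v ℤ.≟ + n)
    (vecsOver-complete v (ℕP.≤-reflexive
      (ℤP.+-injective (trans (sym (sumOfSquares-norm v)) h)))) h)

representations-unique : ∀ k n → Unique (representations k n)
representations-unique k n = Uniq.filter⁺ (λ v → sumOfSquares v ℤ.≟ + n)
  (vecsOver-unique (symRange-unique n) k)

{-# OPTIONS --safe #-}

-- Replacing q by −q turns the generating function of pod into 1/ψ, where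
-- ψ = Σ_s q^(s(s+1)/2) (Gauss); so with Θ = 2ψ and A = Σ (−1)^n pod(n) q^n we
-- have A Θ = 2.  The coefficient of q^n in Θ^k counts the x ∈ ℤᵏ with all entries
-- odd and |x|² = 8n + k.  Mod 5, Θ⁵ = Θ(q⁵), so A Θ(q⁵) = 2Θ⁴, and it remains to
-- see that the coefficients of Θ⁴ at 5n + 2 and n agree: then Σ A(5n+2) q^n = 2Θ³,
-- and a sum of three squares equal to 8n + 3 has only odd terms.
--
-- For Θ⁴, let α run over the six quaternions 1 ± 2i, 1 ± 2j, 1 ± 2k of norm 5.
-- If |x|² = 5N, then x ∈ αℤ⁴ for one α, or for all six; counting the pairs (x , α)
-- through y = α⁻¹x shows #{|x|² = 5N} ≡ 6 #{|y|² = N} mod 5, and left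
-- multiplication by α preserves parities.

module Submission where

open import Defs
open import Data.Integer as ℤ using (ℤ; +_; -[1+_]; -1ℤ)
open import Algebra.Bundles using (CommutativeRing)
open import Algebra.Structures using (IsCommutativeRing)
open import Data.Bool using (true; false)
open import Data.Empty using (⊥; ⊥-elim)
open import Data.Fin using (Fin)
open import Data.Fin.Patterns using (0F; 1F; 2F; 3F)
import Data.Integer.DivMod as ℤDM
import Data.Integer.Divisibility.Signed as ℤDiv
import Data.Integer.Properties as ℤP
import Data.Integer.Tactic.RingSolver as ℤSolver
open import Data.List
  using (List; []; _∷_; _++_; map; filter; length; cartesianProductWith; downFrom)
open import Data.List.Membership.Propositional using (_∈_)
open import Data.List.Membership.Propositional.Properties
  using (∈-map⁺; ∈-map⁻; ∈-++⁺ˡ; ∈-++⁺ʳ; ∈-++⁻; ∈-filter⁺; ∈-filter⁻; ∈-downFrom⁺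
        ; ∈-cartesianProductWith⁺; ∈-cartesianProductWith⁻)
open import Data.List.Membership.Propositional.Properties.WithK using (unique∧set⇒bag)
import Data.List.Properties as LP
open import Data.List.Relation.Binary.BagAndSetEquality using (∼bag⇒↭)
open import Data.List.Relation.Binary.Permutation.Propositional.Properties using (↭-length)
open import Data.List.Relation.Unary.All as All using (All; []; _∷_)
open import Data.List.Relation.Unary.AllPairs using ([]; _∷_)
open import Data.List.Relation.Unary.Linked.Properties using (Linked⇒AllPairs; AllPairs⇒Linked)
open import Data.List.Relation.Unary.Unique.Propositional using (Unique)
import Data.List.Relation.Unary.Unique.Propositional.Properties as Uniq
open import Data.Nat as ℕ using (ℕ; zero; suc; z≤n; s≤s; _≤_; _≥_)
import Data.Nat.DivMod as ℕDM
open import Data.Nat.Divisibility as ℕDiv using (_∣_; _∣?_)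
open import Data.Nat.Induction using (<-rec)
open import Data.Nat.ListAction using (sum)
import Data.Nat.Properties as ℕP
import Data.Nat.Tactic.RingSolver as ℕSolver
open import Data.Product using (_×_; _,_; proj₁; proj₂; ∃; ∃₂)
open import Data.Sum using (_⊎_; inj₁; inj₂; [_,_])
open import Data.Unit using (tt)
open import Data.Vec as Vec using (Vec; []; _∷_; lookup)
import Data.Vec.Properties as VP
open import Data.Vec.Relation.Unary.All as VAll using ([]; _∷_)
open import Function using (_∘_)
open import Function.Bundles using (_⇔_; mk⇔; Equivalence)
open import Level using (0ℓ)
open import Relation.Binary.PropositionalEquality as ≡ using (_≡_; _≢_; cong; cong₂; subst)
import Relation.Binary.Reasoning.Setoid as SetoidReasoning
open import Relation.Nullary using (Dec; does; yes; no; ¬_; ¬?)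
open import Relation.Nullary.Decidable using (toWitness; toWitnessFalse; _→-dec_)
open import Relation.Unary using (Decidable)

-- Formal power series

-- Modulo 5 the quaternions become the 2×2 matrices over F₅, with the norm as determinant. A nonzero
-- x of norm divisible by 5 then has rank one, and x lies in αℤ⁴ exactly when its image is the line
-- that is the image of α. The six α give the six points of the projective line over F₅, hence
-- exactly one α fits x; the code verifies this on all 5⁴ residues. The congruence so obtained
-- stands in for Jacobi's formula 16σ(2n + 1) for the coefficients of Θ⁴, combined with σ(5m) ≡ σ(m)
-- mod 5. The residue 2 comes from 8(5n + 2) + 4 = 5(8n + 4). Gauss's identity is reached without
-- infinite products. With h_n the signed generating function for parts at most 2n, Shanks' identity
-- h_n Σ_{s≤2n} q^(s(s+1)/2) = Σ_{s≤n} h_s q^((2n+1)s) has right-hand side 1 + O(q^(2n+1)). The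
-- factors of h_n enter through recurrences, never as quotients.

module PowerSeries {c ℓ} (R : CommutativeRing c ℓ) where

  open CommutativeRing R
  open import Algebra.Solver.Ring.NaturalCoefficients.Default commutativeSemiring
  open SetoidReasoning setoid
  open import Algebra.Properties.Ring ring using (+-cancelʳ)

  Series : Set c
  Series = ℕ → Carrier

  infix  4 _≋_
  infixl 6 _⊕_
  infixl 7 _∗_

  _≋_ : Series → Series → Set ℓ
  f ≋ g = ∀ n → f n ≈ g n

  tail : Series → Series
  tail f n = f (suc n)

  _⊕_ : Series → Series → Series
  (f ⊕ g) n = f n + g n

  ⊖_ : Series → Series
  (⊖ f) n = - f n

  const : Carrier → Series
  const a zero    = a
  const a (suc n) = 0#

  𝟘 𝟙 X : Series
  𝟘 n = 0#
  𝟙   = const 1#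
  X zero    = 0#
  X (suc n) = 𝟙 n

  _∗_ : Series → Series → Series
  (f ∗ g) zero    = f 0 * g 0
  (f ∗ g) (suc n) = f 0 * g (suc n) + (tail f ∗ g) n

  -- Coefficient `n` of a product sees nothing beyond index `n` in either factor. `X^-cancel` and
  -- `gauss` rely on this where the factors are known to agree only up to some degree.
  ∗-cong-≤ : ∀ {f f′ g g′} n → (∀ {i} → i ℕ.≤ n → f i ≈ f′ i) →
    (∀ {i} → i ℕ.≤ n → g i ≈ g′ i) → (f ∗ g) n ≈ (f′ ∗ g′) n
  ∗-cong-≤ zero    p q = *-cong (p z≤n) (q z≤n)
  ∗-cong-≤ (suc n) p q = +-cong (*-cong (p z≤n) (q ℕP.≤-refl))
    (∗-cong-≤ n (λ i≤n → p (s≤s i≤n)) (λ i≤n → q (ℕP.m≤n⇒m≤1+n i≤n)))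

  ∗-cong : ∀ {f f′ g g′} → f ≋ f′ → g ≋ g′ → f ∗ g ≋ f′ ∗ g′
  ∗-cong p q n = ∗-cong-≤ n (λ {i} _ → p i) (λ {i} _ → q i)

  ∗-zeroˡ : ∀ f → 𝟘 ∗ f ≋ 𝟘
  ∗-zeroˡ f zero    = zeroˡ _
  ∗-zeroˡ f (suc n) = trans (+-cong (zeroˡ _) (∗-zeroˡ f n)) (+-identityˡ _)

  const-∗ : ∀ a f n → (const a ∗ f) n ≈ a * f n
  const-∗ a f zero    = refl
  const-∗ a f (suc n) = trans (+-congˡ (∗-zeroˡ f n)) (+-identityʳ _)

  ∗-identityˡ : ∀ f → 𝟙 ∗ f ≋ f
  ∗-identityˡ f n = trans (const-∗ 1# f n) (*-identityˡ _)

  ∗-distribʳ : ∀ h f g → (f ⊕ g) ∗ h ≋ f ∗ h ⊕ g ∗ h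
  ∗-distribʳ h f g zero    = distribʳ _ _ _
  ∗-distribʳ h f g (suc n) = trans (+-congˡ (∗-distribʳ h (tail f) (tail g) n))
    (solve 5 (λ a b x u v → (a :+ b) :* x :+ (u :+ v)
                         := a :* x :+ u :+ (b :* x :+ v)) refl
      (f 0) (g 0) (h (suc n)) ((tail f ∗ h) n) ((tail g ∗ h) n))

  -- The definition peels coefficients off the left factor; the mirror image of that recursion is
  -- what commutativity needs.
  ∗-unfoldʳ : ∀ f g n → (f ∗ g) (suc n) ≈ f (suc n) * g 0 + (f ∗ tail g) n
  ∗-unfoldʳ f g zero    = +-comm _ _
  ∗-unfoldʳ f g (suc n) = trans (+-congˡ (∗-unfoldʳ (tail f) g n))
    (solve 3 (λ a b x → a :+ (b :+ x) := b :+ (a :+ x)) refl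
      (f 0 * g (suc (suc n))) (f (suc (suc n)) * g 0) ((tail f ∗ tail g) n))

  ∗-comm : ∀ f g → f ∗ g ≋ g ∗ f
  ∗-comm f g zero    = *-comm _ _
  ∗-comm f g (suc n) = trans (+-cong (*-comm _ _) (∗-comm (tail f) g n))
    (sym (∗-unfoldʳ g f n))

  scale-∗ : ∀ a f g n → ((λ i → a * f i) ∗ g) n ≈ a * (f ∗ g) n
  scale-∗ a f g zero    = *-assoc _ _ _
  scale-∗ a f g (suc n) = trans (+-cong (*-assoc _ _ _) (scale-∗ a (tail f) g n))
    (sym (distribˡ _ _ _))

  ∗-assoc : ∀ f g h → (f ∗ g) ∗ h ≋ f ∗ (g ∗ h)
  ∗-assoc f g h zero    = *-assoc _ _ _
  ∗-assoc f g h (suc n) = begin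
    f 0 * g 0 * h (suc n) + (((λ i → f 0 * tail g i) ⊕ (tail f ∗ g)) ∗ h) n
      ≈⟨ +-congˡ (∗-distribʳ h _ _ n) ⟩
    f 0 * g 0 * h (suc n)
      + (((λ i → f 0 * tail g i) ∗ h) n + ((tail f ∗ g) ∗ h) n)
      ≈⟨ +-congˡ (+-cong (scale-∗ (f 0) (tail g) h n) (∗-assoc (tail f) g h n)) ⟩
    f 0 * g 0 * h (suc n) + (f 0 * (tail g ∗ h) n + (tail f ∗ (g ∗ h)) n)
      ≈⟨ solve 5 (λ a b x u v → a :* b :* x :+ (a :* u :+ v)
                             := a :* (b :* x :+ u) :+ v) refl
           (f 0) (g 0) (h (suc n)) ((tail g ∗ h) n) ((tail f ∗ (g ∗ h)) n) ⟩
    f 0 * (g ∗ h) (suc n) + (tail f ∗ (g ∗ h)) n ∎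

  ∗-isCommutativeRing : IsCommutativeRing _≋_ _⊕_ _∗_ ⊖_ 𝟘 𝟙
  ∗-isCommutativeRing = record
    { isRing = record
      { +-isAbelianGroup = record
        { isGroup = record
          { isMonoid = record
            { isSemigroup = record
              { isMagma = record
                { isEquivalence = record
                  { refl  = λ n → refl
                  ; sym   = λ p n → sym (p n)
                  ; trans = λ p q n → trans (p n) (q n)
                  }
                ; ∙-cong = λ p q n → +-cong (p n) (q n)
                }
              ; assoc = λ f g h n → +-assoc (f n) (g n) (h n)
              }
            ; identity = (λ f n → +-identityˡ (f n)) , (λ f n → +-identityʳ (f n))
            }
          ; inverse = (λ f n → -‿inverseˡ (f n)) , (λ f n → -‿inverseʳ (f n))
          ; ⁻¹-cong = λ p n → -‿cong (p n)
          }
        ; comm = λ f g n → +-comm (f n) (g n)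
        }
      ; *-cong     = ∗-cong
      ; *-assoc    = ∗-assoc
      ; *-identity = ∗-identityˡ
          , λ f n → trans (∗-comm f 𝟙 n) (∗-identityˡ f n)
      ; distrib    = (λ f g h n → trans (∗-comm f (g ⊕ h) n)
          (trans (∗-distribʳ f g h n) (+-cong (∗-comm g f n) (∗-comm h f n))))
          , ∗-distribʳ
      }
    ; *-comm = ∗-comm
    }

  seriesRing : CommutativeRing c ℓ
  seriesRing = record { isCommutativeRing = ∗-isCommutativeRing }

  open import Algebra.Properties.CommutativeSemiring.Exp
    (CommutativeRing.commutativeSemiring seriesRing) public
    using () renaming (_^_ to _^ˢ_; ^-congˡ to ^ˢ-congˡ; ^-distrib-* to ^ˢ-distrib-∗)

  X-∗-zero : ∀ f → (X ∗ f) 0 ≈ 0#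
  X-∗-zero f = zeroˡ _

  X-∗-suc : ∀ f n → (X ∗ f) (suc n) ≈ f n
  X-∗-suc f n = trans (+-congʳ (zeroˡ _)) (trans (+-identityˡ _) (∗-identityˡ f n))

  X^-∗-< : ∀ k f {n} → n ℕ.< k → (X ^ˢ k ∗ f) n ≈ 0#
  X^-∗-< (suc k) f {zero}  _         = trans (∗-assoc X (X ^ˢ k) f 0) (X-∗-zero (X ^ˢ k ∗ f))
  X^-∗-< (suc k) f {suc n} (s≤s n<k) = trans (∗-assoc X (X ^ˢ k) f (suc n))
    (trans (X-∗-suc (X ^ˢ k ∗ f) n) (X^-∗-< k f n<k))

  X^-∗-+ : ∀ k f n → (X ^ˢ k ∗ f) (k ℕ.+ n) ≈ f n
  X^-∗-+ zero    f n = ∗-identityˡ f n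
  X^-∗-+ (suc k) f n = trans (∗-assoc X (X ^ˢ k) f (suc (k ℕ.+ n)))
    (trans (X-∗-suc (X ^ˢ k ∗ f) (k ℕ.+ n)) (X^-∗-+ k f n))

  module _ where
    open CommutativeRing seriesRing using () renaming (*-identityʳ to ∗-identityʳ)

    X^-≡ : ∀ k → (X ^ˢ k) k ≈ 1#
    X^-≡ k = trans (sym (∗-identityʳ (X ^ˢ k) k))
      (≡.subst (λ n → (X ^ˢ k ∗ 𝟙) n ≈ 1#) (ℕP.+-identityʳ k) (X^-∗-+ k 𝟙 0))

    X^-≢ : ∀ k {n} → k ≡.≢ n → (X ^ˢ k) n ≈ 0#
    X^-≢ zero    {zero}  p = ⊥-elim (p ≡.refl)
    X^-≢ zero    {suc n} p = refl
    X^-≢ (suc k) {zero}  p = X-∗-zero (X ^ˢ k)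
    X^-≢ (suc k) {suc n} p =
      trans (X-∗-suc (X ^ˢ k) n) (X^-≢ k (λ e → p (≡.cong suc e)))

  -- Subtraction-free form of: 1 − X^(k+1) is not a zero divisor.
  X^-cancel : ∀ k f g → f ⊕ X ^ˢ suc k ∗ g ≋ g ⊕ X ^ˢ suc k ∗ f → f ≋ g
  X^-cancel k f g eq n = <-rec (λ n → f n ≈ g n) step n
    where
    -- The positive power of `X` shifts indices up, so coefficient `n` of the product uses only
    -- coefficients below `n`, where the strong induction hypothesis applies.
    X^-∗-cong : ∀ n → (∀ {i} → i ℕ.< n → f i ≈ g i) →
      (X ^ˢ suc k ∗ f) n ≈ (X ^ˢ suc k ∗ g) n
    X^-∗-cong zero    p = trans (X^-∗-< (suc k) f (s≤s z≤n)) (sym (X^-∗-< (suc k) g (s≤s z≤n)))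
    X^-∗-cong (suc n) p = begin
      (X ^ˢ suc k ∗ f) (suc n)    ≈⟨ ∗-assoc X (X ^ˢ k) f (suc n) ⟩
      (X ∗ (X ^ˢ k ∗ f)) (suc n)  ≈⟨ X-∗-suc (X ^ˢ k ∗ f) n ⟩
      (X ^ˢ k ∗ f) n              ≈⟨ ∗-cong-≤ n (λ _ → refl) (λ i≤n → p (s≤s i≤n)) ⟩
      (X ^ˢ k ∗ g) n              ≈⟨ X-∗-suc (X ^ˢ k ∗ g) n ⟨
      (X ∗ (X ^ˢ k ∗ g)) (suc n)  ≈⟨ ∗-assoc X (X ^ˢ k) g (suc n) ⟨
      (X ^ˢ suc k ∗ g) (suc n)    ∎

    step : ∀ n → (∀ {i} → i ℕ.< n → f i ≈ g i) → f n ≈ g n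
    step n p = +-cancelʳ _ _ _ (trans (eq n) (+-congˡ (X^-∗-cong n p)))

  X∗tail : ∀ f → f ≋ const (f 0) ⊕ X ∗ tail f
  X∗tail f zero    = sym (trans (+-congˡ (X-∗-zero (tail f))) (+-identityʳ _))
  X∗tail f (suc n) = sym (trans (+-identityˡ _) (X-∗-suc (tail f) n))

  -- f(X⁵)
  expand : Series → Series
  expand f 0 = f 0
  expand f 1 = 0#
  expand f 2 = 0#
  expand f 3 = 0#
  expand f 4 = 0#
  expand f (suc (suc (suc (suc (suc n))))) = expand (tail f) n

  sect : Series → Series
  sect f n = f (2 ℕ.+ n ℕ.* 5)

  -- A series in X⁵ moves indices by multiples of 5 only, so it respects the class 2 mod 5. Four of
  -- every five terms of the product carry a zero coefficient of `expand f`; they are what `drop`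
  -- removes.
  sect-expand-∗ : ∀ f g → sect (expand f ∗ g) ≋ f ∗ sect g
  sect-expand-∗ f g zero = trans
    (+-congˡ (trans (+-cong (zeroˡ _) (zeroˡ _)) (+-identityˡ _))) (+-identityʳ _)
  sect-expand-∗ f g (suc n) = +-congˡ
    (drop (drop (drop (drop (sect-expand-∗ (tail f) g n)))))
    where
    drop : ∀ {a b d} → a ≈ b → 0# * d + a ≈ b
    drop p = trans (+-cong (zeroˡ _) p) (+-identityˡ _)

-- Triangular numbers and Gauss's identity in finite form

tri : ℕ → ℕ
tri zero    = 0
tri (suc n) = suc n ℕ.+ tri n

-- The factor 2n + 1 is kept in front, here and in `tri-odd`, so that q to a triangular number can
-- be read as a power of q^(2n+1), the variable in Shanks' identity.
tri-even : ∀ n → tri (2 ℕ.* n) ≡ suc (2 ℕ.* n) ℕ.* n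
tri-even zero    = ≡.refl
tri-even (suc n) = ≡.trans (≡.cong tri (ℕP.*-suc 2 n))
  (≡.trans (≡.cong (λ t → 2 ℕ.+ 2 ℕ.* n ℕ.+ (1 ℕ.+ 2 ℕ.* n ℕ.+ t)) (tri-even n)) (poly n))
  where
  poly : ∀ n → 2 ℕ.+ 2 ℕ.* n ℕ.+ (1 ℕ.+ 2 ℕ.* n ℕ.+ suc (2 ℕ.* n) ℕ.* n)
             ≡ suc (2 ℕ.* suc n) ℕ.* suc n
  poly = ℕSolver.solve-∀

tri-odd : ∀ n → tri (suc (2 ℕ.* n)) ≡ suc (2 ℕ.* n) ℕ.* suc n
tri-odd n = ≡.trans (≡.cong (suc (2 ℕ.* n) ℕ.+_) (tri-even n))
  (≡.sym (ℕP.*-suc (suc (2 ℕ.* n)) n))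

module Sums {c ℓ} (R : CommutativeRing c ℓ) where

  open CommutativeRing R
  open import Algebra.Properties.CommutativeSemiring.Exp commutativeSemiring

  powerSum : (ℕ → Carrier) → Carrier → ℕ → Carrier
  powerSum h z zero    = h 0
  powerSum h z (suc m) = powerSum h z m + h (suc m) * z ^ suc m

  triSum : Carrier → ℕ → Carrier
  triSum q zero    = 0#
  triSum q (suc n) = triSum q n + q ^ tri n

module Shanks {c ℓ} (R : CommutativeRing c ℓ) (q : CommutativeRing.Carrier R) where

  open CommutativeRing R
  open import Algebra.Properties.CommutativeSemiring.Exp commutativeSemiring
  open import Algebra.Solver.Ring.NaturalCoefficients.Default commutativeSemiring
  open import Algebra.Properties.Ring ring using (+-cancelʳ)
  open SetoidReasoning setoid
  open Sums R

  -- Up to the factor h₀, `h` is the product over i ≤ m of (1 - q^(2i-1)) / (1 - q^(2i)). Only its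
  -- recurrence is assumed, and `cancel` takes the place of division by 1 - q^(k+1), so no inverses
  -- have to exist in the ring.
  module _
    (h : ℕ → Carrier)
    (h-rec : ∀ m → h (suc m) + h m * q ^ suc (2 ℕ.* m)
                 ≈ h m + h (suc m) * q ^ suc (suc (2 ℕ.* m)))
    (cancel : ∀ k a b → a + q ^ suc k * b ≈ b + q ^ suc k * a → a ≈ b)
    where

    -- (1 − z) Σ_{s≤m} h_s z^s − (1 − z q) Σ_{s≤m} h_s (z q²)^s
    --   = − h_m (1 − q^(2m+1)) z^(m+1), without subtractions.
    telescope : ∀ z m → let z′ = z * (q * q) in
      powerSum h z m + z * q * powerSum h z′ m + h m * z ^ suc m
        ≈ powerSum h z′ m + z * powerSum h z m + h m * (q ^ suc (2 ℕ.* m) * z ^ suc m)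
    telescope z zero = solve 3
      (λ a z q → a :+ z :* q :* a :+ a :* (z :* con 1)
               := a :+ z :* a :+ a :* (q :* con 1 :* (z :* con 1))) refl (h 0) z q
    -- The right-hand sides of the induction hypothesis and of `h-rec` (times `w`) are added to both
    -- sides. After regrouping, the left-hand sides of these two equations appear and are traded for
    -- the right-hand ones, which then cancel.
    telescope z (suc m) = +-cancelʳ (Z + w * (g + g′ * (q * p))) _ _ (begin
      L′ + (Z + w * (g + g′ * (q * p)))
        ≈⟨ +-congʳ (+-congʳ (+-congˡ (*-congˡ (+-congˡ (*-congˡ w′))))) ⟩
      S + g′ * w + z * q * (S′ + g′ * (w * (q * p))) + g′ * (z * w)
        + (Z + w * (g + g′ * (q * p)))
        ≈⟨ solve 8 (λ S S′ g g′ p q z w →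
             S :+ g′ :* w :+ z :* q :* (S′ :+ g′ :* (w :* (q :* p))) :+ g′ :* (z :* w)
               :+ (S′ :+ z :* S :+ g :* (p :* w) :+ w :* (g :+ g′ :* (q :* p)))
             := S′ :+ g′ :* (w :* (q :* p)) :+ z :* (S :+ g′ :* w)
               :+ g′ :* (q :* (q :* p) :* (z :* w))
               :+ (S :+ z :* q :* S′ :+ g :* w :+ w :* (g′ :+ g :* p)))
             refl S S′ g g′ p q z w ⟩
      S′ + g′ * (w * (q * p)) + z * (S + g′ * w) + g′ * (q * (q * p) * (z * w))
        + (S + z * q * S′ + g * w + w * (g′ + g * p))
        ≈⟨ +-cong (+-cong (+-congʳ (+-congˡ (*-congˡ w′)))
                          (*-congˡ (*-congʳ (^-congʳ q (≡.cong suc (ℕP.*-suc 2 m))))))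
                  (+-cong (sym (telescope z m)) (*-congˡ (sym (h-rec m)))) ⟨
      R′ + (Z + w * (g + g′ * (q * p))) ∎)
      where
      p w S S′ g g′ Z L′ R′ : Carrier
      p  = q ^ suc (2 ℕ.* m)
      w  = z ^ suc m
      S  = powerSum h z m
      S′ = powerSum h (z * (q * q)) m
      g  = h m
      g′ = h (suc m)
      Z  = S′ + z * S + g * (p * w)
      L′ = S + g′ * w + z * q * (S′ + g′ * (z * (q * q)) ^ suc m) + g′ * (z * w)
      R′ = S′ + g′ * (z * (q * q)) ^ suc m + z * (S + g′ * w)
             + g′ * (q ^ suc (2 ℕ.* suc m) * (z * w))
      w′ : (z * (q * q)) ^ suc m ≈ w * (q * p)
      w′ = begin
        (z * (q * q)) ^ suc m           ≈⟨ ^-distrib-* z (q * q) (suc m) ⟩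
        w * (q * q) ^ suc m             ≈⟨ *-congˡ (^-distrib-* q q (suc m)) ⟩
        w * (q ^ suc m * q ^ suc m)     ≈⟨ *-congˡ (^-homo-* q (suc m) (suc m)) ⟨
        w * q ^ (suc m ℕ.+ suc m)       ≈⟨ *-congˡ (^-congʳ q (double m)) ⟩
        w * (q * p)                     ∎
        where
        double : ∀ m → suc m ℕ.+ suc m ≡ suc (suc (2 ℕ.* m))
        double = ℕSolver.solve-∀

    -- Shanks' finite form of Gauss's product for Σ_s q^(s(s+1)/2).
    shanks : ∀ n → h n * triSum q (suc (2 ℕ.* n)) ≈ powerSum h (q ^ suc (2 ℕ.* n)) n
    shanks zero    = solve 1 (λ a → a :* (con 0 :+ con 1) := a) refl (h 0)
    shanks (suc n) = begin
      g′ * triSum q (suc (2 ℕ.* suc n))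
        ≈⟨ *-congˡ (reflexive (≡.cong (λ k → triSum q (suc k)) (ℕP.*-suc 2 n))) ⟩
      g′ * (Ψ + q ^ tri (suc (2 ℕ.* n)) + q ^ tri (suc (suc (2 ℕ.* n))))
        ≈⟨ *-congˡ (+-cong (+-congˡ e₁) e₂) ⟩
      g′ * (Ψ + w + y)              ≈⟨ distribˡ g′ (Ψ + w) y ⟩
      g′ * (Ψ + w) + g′ * y         ≈⟨ +-congʳ (cancel (suc (2 ℕ.* n)) _ _ key) ⟩
      powerSum h (z * (q * q)) n + g′ * y
        ≈⟨ +-cong (powerSum-cong n z′) (*-congˡ (^-congˡ (suc n) z′)) ⟩
      powerSum h (q ^ suc (2 ℕ.* suc n)) (suc n) ∎
      where
      z w y Ψ g g′ S S′ : Carrier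
      z  = q ^ suc (2 ℕ.* n)
      w  = z ^ suc n
      y  = (z * (q * q)) ^ suc n
      Ψ  = triSum q (suc (2 ℕ.* n))
      g  = h n
      g′ = h (suc n)
      S  = powerSum h z n
      S′ = powerSum h (z * (q * q)) n
      z′ : z * (q * q) ≈ q ^ suc (2 ℕ.* suc n)
      z′ = trans (solve 2 (λ z q → z :* (q :* q) := q :* (q :* z)) refl z q)
        (^-congʳ q (≡.cong suc (≡.sym (ℕP.*-suc 2 n))))
      e₁ : q ^ tri (suc (2 ℕ.* n)) ≈ w
      e₁ = trans (^-congʳ q (tri-odd n)) (sym (^-assocʳ q (suc (2 ℕ.* n)) (suc n)))
      e₂ : q ^ tri (suc (suc (2 ℕ.* n))) ≈ y
      e₂ = begin
        q ^ tri (suc (suc (2 ℕ.* n)))  ≈⟨ ^-congʳ q (≡.cong tri (ℕP.*-suc 2 n)) ⟨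
        q ^ tri (2 ℕ.* suc n)          ≈⟨ ^-congʳ q (tri-even (suc n)) ⟩
        q ^ (suc (2 ℕ.* suc n) ℕ.* suc n) ≈⟨ ^-assocʳ q (suc (2 ℕ.* suc n)) (suc n) ⟨
        (q ^ suc (2 ℕ.* suc n)) ^ suc n   ≈⟨ ^-congˡ (suc n) z′ ⟨
        y                              ∎
      powerSum-cong : ∀ m {x y} → x ≈ y → powerSum h x m ≈ powerSum h y m
      powerSum-cong zero    p = refl
      powerSum-cong (suc m) p = +-cong (powerSum-cong m p) (*-congˡ (^-congˡ (suc m) p))
      -- The goal `g′ * (Ψ + w)` = `S′` multiplied by 1 - qz, where qz = q^(2n+2). By `h-rec`, (1 -
      -- qz) g′ = (1 - z) g; the induction hypothesis gives gΨ = S; and `telescope`, whose q^(2n+1)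
      -- is `z` itself here, says (1 - z)(S + gw) = (1 - qz) S′.
      key : g′ * (Ψ + w) + q * z * S′ ≈ S′ + q * z * (g′ * (Ψ + w))
      key = +-cancelʳ (g * z * (Ψ + w)) _ _ (begin
        g′ * (Ψ + w) + q * z * S′ + g * z * (Ψ + w)
          ≈⟨ solve 7 (λ g g′ Ψ w q z S′ →
               g′ :* (Ψ :+ w) :+ q :* z :* S′ :+ g :* z :* (Ψ :+ w)
               := (g′ :+ g :* z) :* (Ψ :+ w) :+ q :* z :* S′) refl g g′ Ψ w q z S′ ⟩
        (g′ + g * z) * (Ψ + w) + q * z * S′
          ≈⟨ +-congʳ (*-congʳ (h-rec n)) ⟩
        (g + g′ * (q * z)) * (Ψ + w) + q * z * S′
          ≈⟨ solve 7 (λ g g′ Ψ w q z S′ →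
               (g :+ g′ :* (q :* z)) :* (Ψ :+ w) :+ q :* z :* S′
               := g :* Ψ :+ z :* q :* S′ :+ g :* w :+ q :* z :* (g′ :* (Ψ :+ w)))
               refl g g′ Ψ w q z S′ ⟩
        g * Ψ + z * q * S′ + g * w + q * z * (g′ * (Ψ + w))
          ≈⟨ +-congʳ (+-congʳ (+-congʳ (shanks n))) ⟩
        S + z * q * S′ + g * w + q * z * (g′ * (Ψ + w))
          ≈⟨ +-congʳ (telescope z n) ⟩
        S′ + z * S + g * (z * w) + q * z * (g′ * (Ψ + w))
          ≈⟨ +-congʳ (+-congʳ (+-congˡ (*-congˡ (shanks n)))) ⟨
        S′ + z * (g * Ψ) + g * (z * w) + q * z * (g′ * (Ψ + w))
          ≈⟨ solve 7 (λ g g′ Ψ w q z S′ →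
               S′ :+ z :* (g :* Ψ) :+ g :* (z :* w) :+ q :* z :* (g′ :* (Ψ :+ w))
               := S′ :+ q :* z :* (g′ :* (Ψ :+ w)) :+ g :* z :* (Ψ :+ w))
               refl g g′ Ψ w q z S′ ⟩
        S′ + q * z * (g′ * (Ψ + w)) + g * z * (Ψ + w) ∎)

-- Power series in characteristic 5

HasChar5 : ∀ {c ℓ} → CommutativeRing c ℓ → Set ℓ
HasChar5 R = 1# + 1# + 1# + 1# + 1# ≈ 0#
  where open CommutativeRing R

module Freshman {c ℓ} (R : CommutativeRing c ℓ) (5≈0 : HasChar5 R) where

  open CommutativeRing R
  open import Algebra.Properties.CommutativeSemiring.Exp commutativeSemiring
  open import Algebra.Solver.Ring.NaturalCoefficients.Default commutativeSemiring
  open SetoidReasoning setoid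

  freshman : ∀ x y → (x + y) ^ 5 ≈ x ^ 5 + y ^ 5
  freshman x y = begin
    (x + y) ^ 5
      ≈⟨ solve 2 (λ x y → (x :+ y) :^ 5
           := x :^ 5 :+ y :^ 5 :+ (con 1 :+ con 1 :+ con 1 :+ con 1 :+ con 1)
                :* (x :* y :* (x :^ 3 :+ (con 1 :+ con 1) :* x :^ 2 :* y
                                 :+ (con 1 :+ con 1) :* x :* y :^ 2 :+ y :^ 3)))
           refl x y ⟩
    x ^ 5 + y ^ 5 + (1# + 1# + 1# + 1# + 1#) * _  ≈⟨ +-congˡ (*-congʳ 5≈0) ⟩
    x ^ 5 + y ^ 5 + 0# * _                        ≈⟨ +-congˡ (zeroˡ _) ⟩
    x ^ 5 + y ^ 5 + 0#                            ≈⟨ +-identityʳ _ ⟩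
    x ^ 5 + y ^ 5                                 ∎

module Series5 {c ℓ} (R : CommutativeRing c ℓ) (5≈0 : HasChar5 R) where

  open CommutativeRing R
  open import Algebra.Properties.CommutativeSemiring.Exp commutativeSemiring
  open PowerSeries R
  private module S = CommutativeRing seriesRing

  seriesChar5 : HasChar5 seriesRing
  seriesChar5 zero    = 5≈0
  seriesChar5 (suc n) = trans (+-congʳ (trans (+-congʳ (trans (+-congʳ (+-identityˡ _))
    (+-identityˡ _))) (+-identityˡ _))) (+-identityˡ _)

  const-^ : ∀ a k → const a ^ˢ k ≋ const (a ^ k)
  const-^ a zero    n       = refl
  const-^ a (suc k) zero    = *-congˡ (const-^ a k 0)
  const-^ a (suc k) (suc n) = trans (const-∗ a (const a ^ˢ k) (suc n))
    (trans (*-congˡ (const-^ a k (suc n))) (zeroʳ a))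

  -- The map x ↦ x⁵ is additive, and f = f₀ + X f′ where f′ is the tail of f.
  frobenius : ∀ f → (∀ n → f n ^ 5 ≈ f n) → f ^ˢ 5 ≋ expand f
  frobenius f fermat = go
    where
    split : f ^ˢ 5 ≋ const (f 0 ^ 5) ⊕ X ^ˢ 5 ∗ tail f ^ˢ 5
    split = S.trans (^ˢ-congˡ 5 (X∗tail f)) (S.trans
      (Freshman.freshman seriesRing seriesChar5 (const (f 0)) (X ∗ tail f))
      (S.+-cong (const-^ (f 0) 5) (^ˢ-distrib-∗ X (tail f) 5)))

    low : ∀ {n} → n ℕ.< 5 → (f ^ˢ 5) n ≈ const (f 0 ^ 5) n
    low {n} n<5 = trans (split n) (trans (+-congˡ (X^-∗-< 5 (tail f ^ˢ 5) n<5)) (+-identityʳ _))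

    go : f ^ˢ 5 ≋ expand f
    go 0 = trans (low (ℕ.s≤s ℕ.z≤n)) (fermat 0)
    go 1 = low (ℕP.m≤m+n 2 3)
    go 2 = low (ℕP.m≤m+n 3 2)
    go 3 = low (ℕP.m≤m+n 4 1)
    go 4 = low (ℕP.m≤m+n 5 0)
    -- The recursion passes to the tail of the series, and it terminates because the index drops by
    -- 5.
    go (suc (suc (suc (suc (suc n))))) = trans (split (5 ℕ.+ n))
      (trans (+-identityˡ _) (trans (X^-∗-+ 5 (tail f ^ˢ 5) n)
        (frobenius (tail f) (λ n → fermat (suc n)) n)))

  two : Series
  two = 𝟙 ⊕ 𝟙

  -- A = 2/Θ = 2 Θ⁴/Θ⁵, and Θ⁵ is a series in X⁵.
  sect-inverse : ∀ A Θ → A ∗ Θ ≋ two → (∀ n → Θ n ^ 5 ≈ Θ n) →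
    sect (Θ ^ˢ 4) ≋ Θ ^ˢ 4 → sect A ≋ two ∗ Θ ^ˢ 3
  sect-inverse A Θ AΘ fermat inv = begin
    -- Cancels the 2 of `twice`: `three` inverts `two`, as 3 · 2 = 1 + 5, and then 3 · 2 · 2 = 2 + 5
    -- · 2.
    B                              ≈⟨ S.+-identityʳ B ⟨
    B ⊕ 𝟘                          ≈⟨ S.+-congˡ (S.trans (S.*-congʳ seriesChar5) (S.zeroˡ B)) ⟨
    B ⊕ (𝟙 ⊕ 𝟙 ⊕ 𝟙 ⊕ 𝟙 ⊕ 𝟙) ∗ B
      ≈⟨ solve 1 (λ b → b :+ (con 1 :+ con 1 :+ con 1 :+ con 1 :+ con 1) :* b
                     := (con 1 :+ con 1 :+ con 1) :* ((con 1 :+ con 1) :* b)) S.refl B ⟩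
    three ∗ (two ∗ B)              ≈⟨ S.*-congˡ twice ⟩
    three ∗ (two ∗ (two ∗ T))
      ≈⟨ solve 1 (λ t → (con 1 :+ con 1 :+ con 1) :* ((con 1 :+ con 1) :* ((con 1 :+ con 1) :* t))
                     := (con 1 :+ con 1) :* t
                          :+ (con 1 :+ con 1 :+ con 1 :+ con 1 :+ con 1) :* ((con 1 :+ con 1) :* t))
           S.refl T ⟩
    two ∗ T ⊕ (𝟙 ⊕ 𝟙 ⊕ 𝟙 ⊕ 𝟙 ⊕ 𝟙) ∗ (two ∗ T)
      ≈⟨ S.+-congˡ (S.trans (S.*-congʳ seriesChar5) (S.zeroˡ (two ∗ T))) ⟩
    two ∗ T ⊕ 𝟘                    ≈⟨ S.+-identityʳ (two ∗ T) ⟩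
    two ∗ T                        ∎
    where
    open SetoidReasoning S.setoid
    open import Algebra.Solver.Ring.NaturalCoefficients.Default S.commutativeSemiring
    B T three : Series
    B     = sect A
    T     = Θ ^ˢ 3
    three = 𝟙 ⊕ 𝟙 ⊕ 𝟙

    two-∗ : ∀ f → two ∗ f ≋ f ⊕ f
    two-∗ f = solve 1 (λ f → (con 1 :+ con 1) :* f := f :+ f) S.refl f

    ΘB : Θ ∗ B ≋ two ∗ Θ ^ˢ 4
    ΘB = begin
      Θ ∗ sect A                ≈⟨ sect-expand-∗ Θ A ⟨
      sect (expand Θ ∗ A)       ≈⟨ sect-cong (S.*-congʳ (frobenius Θ fermat)) ⟨
      sect (Θ ^ˢ 5 ∗ A)
        ≈⟨ sect-cong (solve 2 (λ a t → t :^ 5 :* a := a :* t :* t :^ 4) S.refl A Θ) ⟩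
      sect (A ∗ Θ ∗ Θ ^ˢ 4)     ≈⟨ sect-cong (S.*-congʳ AΘ) ⟩
      sect (two ∗ Θ ^ˢ 4)       ≈⟨ sect-cong (two-∗ (Θ ^ˢ 4)) ⟩
      sect (Θ ^ˢ 4) ⊕ sect (Θ ^ˢ 4) ≈⟨ S.+-cong inv inv ⟩
      Θ ^ˢ 4 ⊕ Θ ^ˢ 4           ≈⟨ two-∗ (Θ ^ˢ 4) ⟨
      two ∗ Θ ^ˢ 4              ∎
      where
      sect-cong : ∀ {f g} → f ≋ g → sect f ≋ sect g
      sect-cong p n = p (2 ℕ.+ n ℕ.* 5)

    -- Multiplication by `A` serves as division by `Θ`, at the price of an extra factor 2 on both
    -- sides.
    twice : two ∗ B ≋ two ∗ (two ∗ T)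
    twice = begin
      two ∗ B                   ≈⟨ S.*-congʳ AΘ ⟨
      A ∗ Θ ∗ B                 ≈⟨ S.*-assoc A Θ B ⟩
      A ∗ (Θ ∗ B)               ≈⟨ S.*-congˡ ΘB ⟩
      A ∗ (two ∗ Θ ^ˢ 4)
        ≈⟨ solve 2 (λ a t → a :* ((con 1 :+ con 1) :* t :^ 4)
                         := (con 1 :+ con 1) :* (a :* t :* t :^ 3)) S.refl A Θ ⟩
      two ∗ (A ∗ Θ ∗ T)         ≈⟨ S.*-congˡ (S.*-congʳ AΘ) ⟩
      two ∗ (two ∗ T)           ∎

-- Counting by enumeration

open ≡ using (refl; sym; trans)
open Equivalence using (to; from)

Enumerates : ∀ {A : Set} → (A → Set) → List A → Set
Enumerates P xs = Unique xs × (∀ x → x ∈ xs ⇔ P x)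

module _ {A : Set} {P Q : A → Set} where

  -- Two duplicate-free lists with the same members are permutations of each other. Every equality
  -- of cardinalities below is reduced to this.
  enum-length : ∀ {xs ys} → Enumerates P xs → Enumerates Q ys →
    (∀ x → P x → Q x) → (∀ x → Q x → P x) → length xs ≡ length ys
  enum-length (u , p) (v , q) P⇒Q Q⇒P = ↭-length (∼bag⇒↭ (unique∧set⇒bag u v
    (λ {x} → mk⇔ (from (q x) ∘ P⇒Q x ∘ to (p x)) (from (p x) ∘ Q⇒P x ∘ to (q x)))))

  enum-filter : ∀ {xs} (Q? : Decidable Q) → Enumerates P xs →
    Enumerates (λ x → P x × Q x) (filter Q? xs)
  enum-filter {xs} Q? (u , p) = Uniq.filter⁺ Q? u , λ x → mk⇔
    (λ m → let x∈ , qx = ∈-filter⁻ Q? {xs = xs} m in to (p x) x∈ , qx)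
    (λ (px , qx) → ∈-filter⁺ Q? (from (p x) px) qx)

  enum-++ : ∀ {xs ys} → Enumerates P xs → Enumerates Q ys →
    (∀ x → P x → Q x → ⊥) → Enumerates (λ x → P x ⊎ Q x) (xs ++ ys)
  enum-++ {xs} (u , p) (v , q) dis =
    Uniq.++⁺ u v (λ {x} (a , b) → dis x (to (p x) a) (to (q x) b)) ,
    λ x → mk⇔ (λ m → [ inj₁ ∘ to (p x) , inj₂ ∘ to (q x) ] (∈-++⁻ xs m))
              [ ∈-++⁺ˡ ∘ from (p x) , ∈-++⁺ʳ xs ∘ from (q x) ]

enum-map : ∀ {A B : Set} {P : A → Set} {xs} (f : A → B) →
  (∀ {x y} → f x ≡ f y → x ≡ y) → Enumerates P xs →
  Enumerates (λ y → ∃ λ x → P x × y ≡ f x) (map f xs)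
enum-map {xs = xs} f inj (u , p) = Uniq.map⁺ inj u , λ y → mk⇔
  (λ m → let x , x∈ , eq = ∈-map⁻ f m in x , to (p x) x∈ , eq)
  (λ { (x , px , refl) → ∈-map⁺ f (from (p x) px) })

module ListConvolution {A B C : Set} (f : A → B → C) where

  -- The recursion is that of the series product `_∗_`, so in `length-conv` the lengths follow it
  -- clause by clause.
  conv : (ℕ → List A) → (ℕ → List B) → ℕ → List C
  conv as bs zero    = cartesianProductWith f (as 0) (bs 0)
  conv as bs (suc n) = cartesianProductWith f (as 0) (bs (suc n)) ++ conv (as ∘ suc) bs n

  -- The pieces for different `i` must not overlap; this is why `x` is required to determine its
  -- index.
  enum-conv : (∀ {w x y z} → f w y ≡ f x z → w ≡ x × y ≡ z) →
    ∀ {P : ℕ → A → Set} {Q : ℕ → B → Set} as bs →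
    (∀ {i j x} → P i x → P j x → i ≡ j) →
    (∀ i → Enumerates (P i) (as i)) → (∀ j → Enumerates (Q j) (bs j)) → ∀ n →
    Enumerates (λ v → ∃₂ λ i j → i ℕ.+ j ≡ n × ∃₂ λ x y → P i x × Q j y × v ≡ f x y)
      (conv as bs n)
  enum-conv inj {P} {Q} as bs dis ps qs = go as ps dis
    where
    go : ∀ {P : ℕ → A → Set} as → (∀ i → Enumerates (P i) (as i)) →
      (∀ {i j x} → P i x → P j x → i ≡ j) → ∀ n →
      Enumerates (λ v → ∃₂ λ i j → i ℕ.+ j ≡ n × ∃₂ λ x y → P i x × Q j y × v ≡ f x y)
        (conv as bs n)
    go as ps dis zero =
      Uniq.cartesianProductWith⁺ f inj (proj₁ (ps 0)) (proj₁ (qs 0)) ,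
      λ v → mk⇔
        (λ m → let x , y , x∈ , y∈ , eq = ∈-cartesianProductWith⁻ f (as 0) (bs 0) m in
          0 , 0 , refl , x , y , to (proj₂ (ps 0) x) x∈ , to (proj₂ (qs 0) y) y∈ , eq)
        (λ { (zero , zero , _ , x , y , px , qy , refl) →
          ∈-cartesianProductWith⁺ f (from (proj₂ (ps 0) x) px) (from (proj₂ (qs 0) y) qy) })
    go {P} as ps dis (suc n) =
      Uniq.++⁺ (Uniq.cartesianProductWith⁺ f inj (proj₁ (ps 0)) (proj₁ (qs (suc n))))
        (proj₁ rest) disjoint ,
      λ v → mk⇔ (λ m → [ left v , right v ] (∈-++⁻ prod m)) (back v)
      where
      prod : List C
      prod = cartesianProductWith f (as 0) (bs (suc n))
      Rest Whole : C → Set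
      Rest v  = ∃₂ λ i j → i ℕ.+ j ≡ n × ∃₂ λ x y → P (suc i) x × Q j y × v ≡ f x y
      Whole v = ∃₂ λ i j → i ℕ.+ j ≡ suc n × ∃₂ λ x y → P i x × Q j y × v ≡ f x y
      rest : Enumerates Rest (conv (as ∘ suc) bs n)
      rest = go (as ∘ suc) (ps ∘ suc) (λ p p′ → ℕP.suc-injective (dis p p′)) n
      left : ∀ v → v ∈ prod → Whole v
      left v m = let x , y , x∈ , y∈ , eq = ∈-cartesianProductWith⁻ f (as 0) (bs (suc n)) m in
        0 , suc n , refl , x , y , to (proj₂ (ps 0) x) x∈ , to (proj₂ (qs (suc n)) y) y∈ , eq
      right : ∀ v → v ∈ conv (as ∘ suc) bs n → Whole v
      right v m = let i , j , eq , more = to (proj₂ rest v) m in suc i , j , cong suc eq , more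
      back : ∀ v → Whole v → v ∈ prod ++ conv (as ∘ suc) bs n
      back v (zero , j , refl , x , y , px , qy , refl) = ∈-++⁺ˡ
        (∈-cartesianProductWith⁺ f (from (proj₂ (ps 0) x) px) (from (proj₂ (qs j) y) qy))
      back v (suc i , j , eq , more) =
        ∈-++⁺ʳ prod (from (proj₂ rest v) (i , j , ℕP.suc-injective eq , more))
      disjoint : ∀ {v} → v ∈ prod × v ∈ conv (as ∘ suc) bs n → ⊥
      disjoint (a , b)
        with x , y , x∈ , _ , refl ← ∈-cartesianProductWith⁻ f (as 0) (bs (suc n)) a
           | i , j , _ , x′ , y′ , px′ , _ , eq ← to (proj₂ rest _) b
        with refl , _ ← inj eq
        with () ← dis (to (proj₂ (ps 0) x) x∈) px′

  length-cartesianProductWith : ∀ xs ys →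
    length (cartesianProductWith f xs ys) ≡ length xs ℕ.* length ys
  length-cartesianProductWith []       ys = refl
  length-cartesianProductWith (x ∷ xs) ys = trans (LP.length-++ (map (f x) ys))
    (cong₂ ℕ._+_ (LP.length-map (f x) ys) (length-cartesianProductWith xs ys))

open ListConvolution

-- A record, so that both sides can be inferred from a proof.
infix 4 _≈[_]_

record _≈[_]_ (a : ℤ) (m : ℕ) (b : ℤ) : Set where
  constructor mod
  field unmod : a ≡ b [mod m ]

open _≈[_]_ public

≡⇒≈ : ∀ {m a b} → a ≡ b → a ≈[ m ] b
≡⇒≈ {a = a} refl = mod (ℤDiv.divides (+ 0) (ℤP.+-inverseʳ a))

module _ (m : ℕ) where

  -- The carrier stays ℤ and only the equality is coarsened, so exact counting identities enter the
  -- modular calculation through `≡⇒≈`.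
  ℤ-mod : CommutativeRing 0ℓ 0ℓ
  ℤ-mod = record
    { Carrier = ℤ
    ; _≈_ = _≈[ m ]_
    ; _+_ = ℤ._+_
    ; _*_ = ℤ._*_
    ; -_  = ℤ.-_
    ; 0#  = + 0
    ; 1#  = + 1
    ; isCommutativeRing = record
      { isRing = record
        { +-isAbelianGroup = record
          { isGroup = record
            { isMonoid = record
              { isSemigroup = record
                { isMagma = record
                  { isEquivalence = record
                    { refl  = ≡⇒≈ refl
                    ; sym   = λ {a} {b} (mod p) → via (neg a b) (ℤDiv.∣m⇒∣-m p)
                    ; trans = λ {a} {b} {c} (mod p) (mod q) →
                        via (add a b c) (ℤDiv.∣m∣n⇒∣m+n p q)
                    }
                  ; ∙-cong = λ {a} {b} {c} {d} (mod p) (mod q) →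
                      via (plus a b c d) (ℤDiv.∣m∣n⇒∣m+n p q)
                  }
                ; assoc = λ a b c → ≡⇒≈ (ℤP.+-assoc a b c)
                }
              ; identity = (λ a → ≡⇒≈ (ℤP.+-identityˡ a)) , (λ a → ≡⇒≈ (ℤP.+-identityʳ a))
              }
            ; inverse = (λ a → ≡⇒≈ (ℤP.+-inverseˡ a)) , (λ a → ≡⇒≈ (ℤP.+-inverseʳ a))
            ; ⁻¹-cong = λ {a} {b} (mod p) → via (minus a b) (ℤDiv.∣m⇒∣-m p)
            }
          ; comm = λ a b → ≡⇒≈ (ℤP.+-comm a b)
          }
        ; *-cong = λ {a} {b} {c} {d} (mod p) (mod q) → via (times a b c d)
            (ℤDiv.∣m∣n⇒∣m+n (ℤDiv.∣m⇒∣m*n c p) (ℤDiv.∣n⇒∣m*n b q))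
        ; *-assoc = λ a b c → ≡⇒≈ (ℤP.*-assoc a b c)
        ; *-identity = (λ a → ≡⇒≈ (ℤP.*-identityˡ a)) , (λ a → ≡⇒≈ (ℤP.*-identityʳ a))
        ; distrib = (λ a b c → ≡⇒≈ (ℤP.*-distribˡ-+ a b c))
                  , (λ a b c → ≡⇒≈ (ℤP.*-distribʳ-+ a b c))
        }
      ; *-comm = λ a b → ≡⇒≈ (ℤP.*-comm a b)
      }
    }
    where
    via : ∀ {t a b} → t ≡ a ℤ.- b → + m ℤDiv.∣ t → a ≈[ m ] b
    via refl p = mod p
    neg : ∀ a b → ℤ.- (a ℤ.- b) ≡ b ℤ.- a
    neg = ℤSolver.solve-∀
    add : ∀ a b c → (a ℤ.- b) ℤ.+ (b ℤ.- c) ≡ a ℤ.- c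
    add = ℤSolver.solve-∀
    plus : ∀ a b c d → (a ℤ.- b) ℤ.+ (c ℤ.- d) ≡ (a ℤ.+ c) ℤ.- (b ℤ.+ d)
    plus = ℤSolver.solve-∀
    minus : ∀ a b → ℤ.- (a ℤ.- b) ≡ (ℤ.- a) ℤ.- (ℤ.- b)
    minus = ℤSolver.solve-∀
    times : ∀ a b c d → (a ℤ.- b) ℤ.* c ℤ.+ b ℤ.* (c ℤ.- d) ≡ a ℤ.* c ℤ.- b ℤ.* d
    times = ℤSolver.solve-∀

  open PowerSeries ℤ-mod

  length-conv : ∀ {A B C : Set} (f : A → B → C) as bs n →
    (+ length (conv f as bs n)) ≡
      ((λ i → + length (as i)) ∗ (λ j → + length (bs j))) n
  length-conv f as bs zero = trans (cong +_ (length-cartesianProductWith f (as 0) (bs 0)))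
    (ℤP.pos-* (length (as 0)) (length (bs 0)))
  length-conv f as bs (suc n) = trans
    (cong +_ (LP.length-++ (cartesianProductWith f (as 0) (bs (suc n)))))
    (trans (ℤP.pos-+ _ (length (conv f (as ∘ suc) bs n)))
      (cong₂ ℤ._+_
        (trans (cong +_ (length-cartesianProductWith f (as 0) (bs (suc n))))
          (ℤP.pos-* (length (as 0)) (length (bs (suc n)))))
        (length-conv f (as ∘ suc) bs n)))

-- Odd squares and the powers of Θ

Odd : ℤ → Set
Odd x = x ≡ + 1 [mod 2 ]

odd? : Decidable Odd
odd? x = + 2 ℤDiv.∣? (x ℤ.- + 1)

x≡1+[x-1] : ∀ x → x ≡ + 1 ℤ.+ (x ℤ.- + 1)
x≡1+[x-1] = ℤSolver.solve-∀

-- Odd integers are ±(2s + 1), and both signs have the square 8 `tri s` + 1. The two cases account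
-- for the factor 2 between `Θ` and `ψ`.
odd-form : ∀ x → Odd x → ∃ λ s → x ≡ + suc (2 ℕ.* s) ⊎ x ≡ -[1+ 2 ℕ.* s ]
odd-form x (ℤDiv.divides (+ m) eq) = m , inj₁ (trans (x≡1+[x-1] x)
  (trans (cong ℤ.suc eq) (trans (cong ℤ.suc (sym (ℤP.pos-* m 2))) (cong (+_ ∘ suc) (ℕP.*-comm m 2)))))
odd-form x (ℤDiv.divides -[1+ m ] eq) = m , inj₂ (trans (x≡1+[x-1] x)
  (trans (cong ℤ.suc eq) (cong -[1+_] (ℕP.*-comm m 2))))

odd-pos : ∀ s → Odd (+ suc (2 ℕ.* s))
odd-pos s = ℤDiv.divides (+ s) (trans (cong +_ (ℕP.*-comm 2 s)) (ℤP.pos-* s 2))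

odd-neg : ∀ s → Odd -[1+ 2 ℕ.* s ]
odd-neg s = ℤDiv.divides -[1+ s ] (cong -[1+_]
  (trans (cong suc (ℕP.+-identityʳ (2 ℕ.* s))) (cong suc (ℕP.*-comm 2 s))))

8tri+1 : ∀ s → 8 ℕ.* tri s ℕ.+ 1 ≡ suc (2 ℕ.* s) ℕ.* suc (2 ℕ.* s)
8tri+1 zero    = refl
8tri+1 (suc s) = trans (expandˡ s (tri s)) (trans (cong (8 ℕ.+ 8 ℕ.* s ℕ.+_) (8tri+1 s)) (square s))
  where
  expandˡ : ∀ s t → 8 ℕ.* (suc s ℕ.+ t) ℕ.+ 1 ≡ 8 ℕ.+ 8 ℕ.* s ℕ.+ (8 ℕ.* t ℕ.+ 1)
  expandˡ = ℕSolver.solve-∀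
  square : ∀ s → 8 ℕ.+ 8 ℕ.* s ℕ.+ suc (2 ℕ.* s) ℕ.* suc (2 ℕ.* s)
               ≡ suc (2 ℕ.* suc s) ℕ.* suc (2 ℕ.* suc s)
  square = ℕSolver.solve-∀

square-form : ∀ x s → x ≡ + suc (2 ℕ.* s) ⊎ x ≡ -[1+ 2 ℕ.* s ] →
  x ℤ.* x ≡ + (8 ℕ.* tri s ℕ.+ 1)
square-form _ s (inj₁ refl) = cong +_ (sym (8tri+1 s))
square-form _ s (inj₂ refl) = cong +_ (sym (8tri+1 s))

OddRoot : ℕ → ℤ → Set
OddRoot n x = Odd x × x ℤ.* x ≡ + (8 ℕ.* n ℕ.+ 1)

8*+-injective : ∀ k {i j} → + (8 ℕ.* i ℕ.+ k) ≡ + (8 ℕ.* j ℕ.+ k) → i ≡ j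
8*+-injective k eq = ℕP.*-cancelˡ-≡ _ _ 8 (ℕP.+-cancelʳ-≡ k _ _ (ℤP.+-injective eq))

-- `downFrom` puts the newest candidate at the head, so that raising the bound matches one step of
-- `triSum`. Any bound above `n` gives all roots, since s ≤ `tri s`.
triRoots : ℕ → ℕ → List ℕ
triRoots n k = filter (λ s → tri s ℕ.≟ n) (downFrom k)

oddRoots : ℕ → List ℤ
oddRoots n = map (λ s → + suc (2 ℕ.* s)) (triRoots n (suc n))
          ++ map (λ s → -[1+ 2 ℕ.* s ]) (triRoots n (suc n))

s≤tri : ∀ s → s ℕ.≤ tri s
s≤tri zero    = z≤n
s≤tri (suc s) = ℕP.m≤m+n (suc s) (tri s)

enum-triRoots : ∀ {n k} → n ℕ.< k → Enumerates (λ s → tri s ≡ n) (triRoots n k)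
enum-triRoots {n} {k} n<k = Uniq.filter⁺ P? (Uniq.downFrom⁺ k) , λ s → mk⇔
  (λ m → proj₂ (∈-filter⁻ P? {xs = downFrom k} m))
  (λ eq → ∈-filter⁺ P? (∈-downFrom⁺ (ℕP.≤-<-trans (subst (s ℕ.≤_) eq (s≤tri s)) n<k)) eq)
  where
  P? : Decidable (λ s → tri s ≡ n)
  P? s = tri s ℕ.≟ n

enum-⇔ : ∀ {A : Set} {P Q : A → Set} {xs} → Enumerates P xs → (∀ x → P x ⇔ Q x) → Enumerates Q xs
enum-⇔ (u , p) pq = u , λ x → mk⇔ (to (pq x) ∘ to (p x)) (from (p x) ∘ from (pq x))

enum-oddRoots : ∀ n → Enumerates (OddRoot n) (oddRoots n)
enum-oddRoots n = enum-⇔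
  (enum-++ (enum-map _ (ℕP.*-cancelˡ-≡ _ _ 2 ∘ ℕP.suc-injective ∘ ℤP.+-injective) (enum-triRoots (ℕP.n<1+n n)))
           (enum-map _ (ℕP.*-cancelˡ-≡ _ _ 2 ∘ ℤP.-[1+-injective) (enum-triRoots (ℕP.n<1+n n)))
           (λ { _ (_ , _ , refl) (_ , _ , ()) }))
  λ x → mk⇔
    (λ { (inj₁ (s , refl , refl)) → odd-pos s , square-form x s (inj₁ refl)
       ; (inj₂ (s , refl , refl)) → odd-neg s , square-form x s (inj₂ refl) })
    λ (odd , sq) → let s , form = odd-form x odd in
      roots x s (8*+-injective 1 (trans (sym (square-form x s form)) sq)) form
  where
  roots : ∀ x s → tri s ≡ n → x ≡ + suc (2 ℕ.* s) ⊎ x ≡ -[1+ 2 ℕ.* s ] →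
    (∃ λ s → tri s ≡ n × x ≡ + suc (2 ℕ.* s)) ⊎ (∃ λ s → tri s ≡ n × x ≡ -[1+ 2 ℕ.* s ])
  roots x s eq (inj₁ p) = inj₁ (s , eq , p)
  roots x s eq (inj₂ p) = inj₂ (s , eq , p)

length-oddRoots : ∀ n → length (oddRoots n) ≡
  length (triRoots n (suc n)) ℕ.+ length (triRoots n (suc n))
length-oddRoots n = trans (LP.length-++ (map _ (triRoots n (suc n))))
  (cong₂ ℕ._+_ (LP.length-map _ (triRoots n (suc n))) (LP.length-map _ (triRoots n (suc n))))

-- An odd square is 1 mod 8; with the offset `k` the indices add when a further odd entry is
-- prepended, as in a product of series.
OddRep : ∀ k → ℕ → Vec ℤ k → Set
OddRep k n v = sumOfSquares v ≡ + (8 ℕ.* n ℕ.+ k) × VAll.All Odd v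

oddReps : ∀ k → ℕ → List (Vec ℤ k)
oddReps k n = filter (VAll.all? odd?) (representations k (8 ℕ.* n ℕ.+ k))

enum-representations : ∀ k n → Enumerates (λ v → sumOfSquares v ≡ + n) (representations k n)
enum-representations k n = representations-unique k n , ∈-representations k n

enum-oddReps : ∀ k n → Enumerates (OddRep k n) (oddReps k n)
enum-oddReps k n = enum-filter (VAll.all? odd?) (enum-representations k (8 ℕ.* n ℕ.+ k))

8*+-+ : ∀ i j k → (+ (8 ℕ.* i ℕ.+ 1)) ℤ.+ + (8 ℕ.* j ℕ.+ k) ≡ + (8 ℕ.* (i ℕ.+ j) ℕ.+ suc k)
8*+-+ i j k = cong +_ (poly i j k)
  where
  poly : ∀ i j k → 8 ℕ.* i ℕ.+ 1 ℕ.+ (8 ℕ.* j ℕ.+ k) ≡ 8 ℕ.* (i ℕ.+ j) ℕ.+ suc k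
  poly = ℕSolver.solve-∀

sumOfSquares-odd : ∀ {k} {v : Vec ℤ k} → VAll.All Odd v →
  ∃ λ n → sumOfSquares v ≡ + (8 ℕ.* n ℕ.+ k)
sumOfSquares-odd []       = 0 , refl
sumOfSquares-odd {suc k} {x ∷ _} (o ∷ os) =
  let s , form = odd-form x o
      j , eq   = sumOfSquares-odd os
  in tri s ℕ.+ j , trans (cong₂ ℤ._+_ (square-form x s form) eq) (8*+-+ (tri s) j k)

open ListConvolution

length-oddReps-suc : ∀ k n →
  length (oddReps (suc k) n) ≡ length (conv _∷_ oddRoots (oddReps k) n)
length-oddReps-suc k n = enum-length (enum-oddReps (suc k) n)
  (enum-conv _∷_ VP.∷-injective oddRoots (oddReps k)
    (λ (_ , p) (_ , q) → 8*+-injective 1 (trans (sym p) q))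
    enum-oddRoots (enum-oddReps k) n)
  split join
  where
  Split : Vec ℤ (suc k) → Set
  Split v = ∃₂ λ i j → i ℕ.+ j ≡ n × ∃₂ λ x w → OddRoot i x × OddRep k j w × v ≡ x ∷ w
  split : ∀ v → OddRep (suc k) n v → Split v
  split (x ∷ w) (eq , o ∷ os) =
    let s , form = odd-form x o
        j , eq′  = sumOfSquares-odd os
        sq       = square-form x s form
    in tri s , j
     , 8*+-injective (suc k) (trans (sym (8*+-+ (tri s) j k)) (trans (sym (cong₂ ℤ._+_ sq eq′)) eq))
     , x , w , (o , sq) , (eq′ , os) , refl
  join : ∀ v → Split v → OddRep (suc k) n v
  join _ (i , j , refl , x , w , (o , sq) , (eq , os) , refl) =
    trans (cong₂ ℤ._+_ sq eq) (8*+-+ i j k) , o ∷ os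

module _ (m : ℕ) where

  open PowerSeries (ℤ-mod m)

  Θ : Series
  Θ n = + length (oddRoots n)

  Θ^-coeff : ∀ k → (λ n → + length (oddReps k n)) ≋ Θ ^ˢ k
  Θ^-coeff zero    zero    = ≡⇒≈ refl
  Θ^-coeff zero    (suc n) = ≡⇒≈ refl
  Θ^-coeff (suc k) n = Z.trans
    (≡⇒≈ (trans (cong +_ (length-oddReps-suc k n)) (length-conv m _∷_ oddRoots (oddReps k) n)))
    (∗-cong (λ _ → Z.refl) (Θ^-coeff k) n)
    where module Z = CommutativeRing (ℤ-mod m)

square-mod4 : ∀ x → Odd x × x ℤ.* x ≡ + 1 [mod 4 ] ⊎ x ℤ.* x ≡ + 0 [mod 4 ]
square-mod4 x with x ℤDM.%ℕ 2 | ℤDM.n%ℕd<d x 2 | ℤDM.a≡a%ℕn+[a/ℕn]*n x 2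
... | 0 | _ | eq = inj₂ (ℤDiv.divides (q ℤ.* q) (trans (cong (λ x → x ℤ.* x ℤ.- + 0) eq) (poly q)))
  where
  q = x ℤDM./ℕ 2
  poly : ∀ q → (+ 0 ℤ.+ q ℤ.* + 2) ℤ.* (+ 0 ℤ.+ q ℤ.* + 2) ℤ.- + 0 ≡ q ℤ.* q ℤ.* + 4
  poly = ℤSolver.solve-∀
... | 1 | _ | eq = inj₁
  ( ℤDiv.divides q (trans (cong (ℤ._- + 1) eq) (poly₁ q))
  , ℤDiv.divides (q ℤ.* q ℤ.+ q) (trans (cong (λ x → x ℤ.* x ℤ.- + 1) eq) (poly₂ q)))
  where
  q = x ℤDM./ℕ 2
  poly₁ : ∀ q → (+ 1 ℤ.+ q ℤ.* + 2) ℤ.- + 1 ≡ q ℤ.* + 2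
  poly₁ = ℤSolver.solve-∀
  poly₂ : ∀ q → (+ 1 ℤ.+ q ℤ.* + 2) ℤ.* (+ 1 ℤ.+ q ℤ.* + 2) ℤ.- + 1 ≡ (q ℤ.* q ℤ.+ q) ℤ.* + 4
  poly₂ = ℤSolver.solve-∀
... | suc (suc _) | s≤s (s≤s ()) | _

-- The witness `o` is the number of odd entries: squares are 1 or 0 mod 4 according to parity.
sumOfSquares-mod4 : ∀ {k} (v : Vec ℤ k) →
  ∃ λ o → o ℕ.≤ k × sumOfSquares v ≡ + o [mod 4 ] × (o ≡ k → VAll.All Odd v)
sumOfSquares-mod4 []      = 0 , z≤n , ℤDiv.divides (+ 0) refl , λ _ → []
sumOfSquares-mod4 (x ∷ v) with sumOfSquares-mod4 v | square-mod4 x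
... | o , o≤k , eq , odd | inj₁ (ox , sq) =
  suc o , s≤s o≤k , subst (+ 4 ℤDiv.∣_) (poly (x ℤ.* x) (sumOfSquares v) (+ o)) (ℤDiv.∣m∣n⇒∣m+n sq eq) ,
  λ e → ox ∷ odd (ℕP.suc-injective e)
  where
  poly : ∀ a b c → (a ℤ.- + 1) ℤ.+ (b ℤ.- c) ≡ (a ℤ.+ b) ℤ.- (+ 1 ℤ.+ c)
  poly = ℤSolver.solve-∀
... | o , o≤k , eq , odd | inj₂ sq =
  o , ℕP.m≤n⇒m≤1+n o≤k , subst (+ 4 ℤDiv.∣_) (poly (x ℤ.* x) (sumOfSquares v) (+ o)) (ℤDiv.∣m∣n⇒∣m+n sq eq) ,
  λ { refl → ⊥-elim (ℕP.1+n≰n o≤k) }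
  where
  poly : ∀ a b c → (a ℤ.- + 0) ℤ.+ (b ℤ.- c) ≡ (a ℤ.+ b) ℤ.- c
  poly = ℤSolver.solve-∀

three-odd : ∀ n (v : Vec ℤ 3) → sumOfSquares v ≡ + (8 ℕ.* n ℕ.+ 3) → VAll.All Odd v
three-odd n v eq with sumOfSquares-mod4 v
-- A sum 8n + 3 is 3 mod 4, and among 0, 1, 2, 3 only `o` = 3 has that residue.
... | o , o≤3 , cong4 , odd = odd (only-3 o o≤3 (subst (λ s → s ≡ + o [mod 4 ]) eq cong4))
  where
  residue : ∀ r → + (8 ℕ.* n ℕ.+ 3) ≡ + r [mod 4 ] → + 4 ℤDiv.∣ (+ 3 ℤ.- + r)
  residue r p = ℤDiv.∣m+n∣m⇒∣n (subst (+ 4 ℤDiv.∣_) split p) (ℤDiv.∣n⇒∣m*n (+ (2 ℕ.* n)) ℤDiv.∣-refl)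
    where
    poly : ∀ n → 8 ℕ.* n ℕ.+ 3 ≡ 2 ℕ.* n ℕ.* 4 ℕ.+ 3
    poly = ℕSolver.solve-∀
    split : + (8 ℕ.* n ℕ.+ 3) ℤ.- + r ≡ + (2 ℕ.* n) ℤ.* + 4 ℤ.+ (+ 3 ℤ.- + r)
    split = trans (cong (λ k → + k ℤ.- + r) (poly n))
      (trans (cong (λ k → k ℤ.+ + 3 ℤ.- + r) (ℤP.pos-* (2 ℕ.* n) 4))
        (ℤP.+-assoc (+ (2 ℕ.* n) ℤ.* + 4) (+ 3) (ℤ.- + r)))
  only-3 : ∀ o → o ℕ.≤ 3 → + (8 ℕ.* n ℕ.+ 3) ≡ + o [mod 4 ] → o ≡ 3
  only-3 0 _ p = ⊥-elim (toWitnessFalse {a? = + 4 ℤDiv.∣? + 3} tt (residue 0 p))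
  only-3 1 _ p = ⊥-elim (toWitnessFalse {a? = + 4 ℤDiv.∣? + 2} tt (residue 1 p))
  only-3 2 _ p = ⊥-elim (toWitnessFalse {a? = + 4 ℤDiv.∣? + 1} tt (residue 2 p))
  only-3 3 _ _ = refl
  only-3 (suc (suc (suc (suc _)))) (s≤s (s≤s (s≤s ()))) _

r3-oddReps : ∀ n → r 3 (8 ℕ.* n ℕ.+ 3) ≡ length (oddReps 3 n)
r3-oddReps n = enum-length (enum-representations 3 (8 ℕ.* n ℕ.+ 3)) (enum-oddReps 3 n)
  (λ v eq → eq , three-odd n v eq) (λ _ → proj₁)

-- Quaternions of norm 5

open import Tactic.RingSolver.NonReflective ℤSolver.ring using (Expr; Κ; solve)
  renaming (_⊕_ to _:+_; _⊗_ to _:*_; ⊝_ to :-_; _⊜_ to _:=_)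

Triple : Set → Set
Triple A = A × A × A

-- Opaque: conversion checking explodes when it unfolds the integer products.
opaque
  component : (b c d p q r s : ℤ) → ℤ
  component b c d p q r s = p ℤ.+ + 2 ℤ.* (b ℤ.* q ℤ.+ c ℤ.* r ℤ.+ ℤ.- (d ℤ.* s))

-- Abstract in the carrier, so that the same formula acts on integers and on the polynomial
-- expressions given to the ring solver.
module Quaternion {A : Set} (-_ : A → A) (component : (b c d p q r s : A) → A) where

  -- Left multiplication by the quaternion 1 + 2(bi + cj + dk).
  act : Triple A → Vec A 4 → Vec A 4
  act (b , c , d) (x ∷ y ∷ z ∷ w ∷ []) =
      component (- b) (- c) d x y z w
    ∷ component b c d y x w z
    ∷ component c d b z x y w
    ∷ component d b c w x z y
    ∷ []

  neg : Triple A → Triple A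
  neg (b , c , d) = - b , - c , - d

open Quaternion ℤ.-_ component

module _ {n : ℕ} where

  componentᵖ : (b c d p q r s : Expr ℤ n) → Expr ℤ n
  componentᵖ b c d p q r s = p :+ Κ (+ 2) :* (b :* q :+ c :* r :+ :- (d :* s))

  open Quaternion :-_ componentᵖ public using () renaming (act to actᵖ; neg to negᵖ)

  normSqᵖ : Triple (Expr ℤ n) → Expr ℤ n
  normSqᵖ (b , c , d) = b :* b :+ c :* c :+ d :* d

normSq : Triple ℤ → ℤ
normSq (b , c , d) = b ℤ.* b ℤ.+ c ℤ.* c ℤ.+ d ℤ.* d

IsUnit : Triple ℤ → Set
IsUnit u = normSq u ≡ + 1

units : List (Triple ℤ)
units = (+ 1 , + 0 , + 0) ∷ (ℤ.- + 1 , + 0 , + 0) ∷ (+ 0 , + 1 , + 0)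
      ∷ (+ 0 , ℤ.- + 1 , + 0) ∷ (+ 0 , + 0 , + 1) ∷ (+ 0 , + 0 , ℤ.- + 1) ∷ []

units-isUnit : All IsUnit units
units-isUnit = refl ∷ refl ∷ refl ∷ refl ∷ refl ∷ refl ∷ []

scale : ∀ {k} → Vec ℤ k → Vec ℤ k
scale = Vec.map (+ 5 ℤ.*_)

∷₄-cong : ∀ {a b c d a′ b′ c′ d′ : ℤ} → a ≡ a′ → b ≡ b′ → c ≡ c′ → d ≡ d′ →
  _≡_ {A = Vec ℤ 4} (a ∷ b ∷ c ∷ d ∷ []) (a′ ∷ b′ ∷ c′ ∷ d′ ∷ [])
∷₄-cong refl refl refl refl = refl

-- The solver proves identities valid for every `u`, with factor 1 + 4N for N = `normSq u`; the
-- hypothesis N = 1 enters only here.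
1+4N : ∀ {N a} x → N ≡ + 1 → a ≡ x ℤ.+ + 4 ℤ.* N ℤ.* x → a ≡ + 5 ℤ.* x
1+4N x refl refl = poly x
  where
  poly : ∀ x → x ℤ.+ + 4 ℤ.* + 1 ℤ.* x ≡ + 5 ℤ.* x
  poly = ℤSolver.solve-∀

opaque
  unfolding component

  -- `neg u` gives the conjugate of α = 1 + 2u, and conjugate times α is the norm 1 + 4 `normSq u` =
  -- 5.
  act-neg-act : ∀ u → IsUnit u → ∀ v → act (neg u) (act u v) ≡ scale v
  act-neg-act (b , c , d) e (x ∷ y ∷ z ∷ w ∷ []) = ∷₄-cong
    (1+4N x e (solve 7 (identity 0F) refl b c d x y z w))
    (1+4N y e (solve 7 (identity 1F) refl b c d x y z w))
    (1+4N z e (solve 7 (identity 2F) refl b c d x y z w))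
    (1+4N w e (solve 7 (identity 3F) refl b c d x y z w))
    where
    identity : Fin 4 → (b c d x y z w : Expr ℤ 7) → Expr ℤ 7 × Expr ℤ 7
    identity i b c d x y z w =
      let u = b , c , d
          v = x ∷ y ∷ z ∷ w ∷ []
      in lookup (actᵖ (negᵖ u) (actᵖ u v)) i
         := (lookup v i :+ Κ (+ 4) :* normSqᵖ u :* lookup v i)

  sumOfSquares-act : ∀ u → IsUnit u → ∀ v → sumOfSquares (act u v) ≡ + 5 ℤ.* sumOfSquares v
  sumOfSquares-act (b , c , d) e v@(x ∷ y ∷ z ∷ w ∷ []) =
    1+4N (sumOfSquares v) e (solve 7
      (λ b c d x y z w →
        let u = b , c , d
            v = x ∷ y ∷ z ∷ w ∷ []
        in sumSqᵖ (actᵖ u v) := (sumSqᵖ v :+ Κ (+ 4) :* normSqᵖ u :* sumSqᵖ v))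
      refl b c d x y z w)
    where
    sumSqᵖ : ∀ {k} → Vec (Expr ℤ 7) k → Expr ℤ 7
    sumSqᵖ []       = Κ (+ 0)
    sumSqᵖ (x ∷ xs) = x :* x :+ sumSqᵖ xs

  component-scale : ∀ b c d p q r s →
    component b c d (+ 5 ℤ.* p) (+ 5 ℤ.* q) (+ 5 ℤ.* r) (+ 5 ℤ.* s)
      ≡ + 5 ℤ.* component b c d p q r s
  component-scale = poly
    where
    poly : ∀ b c d p q r s →
      + 5 ℤ.* p ℤ.+ + 2 ℤ.* (b ℤ.* (+ 5 ℤ.* q) ℤ.+ c ℤ.* (+ 5 ℤ.* r) ℤ.+ ℤ.- (d ℤ.* (+ 5 ℤ.* s)))
        ≡ + 5 ℤ.* (p ℤ.+ + 2 ℤ.* (b ℤ.* q ℤ.+ c ℤ.* r ℤ.+ ℤ.- (d ℤ.* s)))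
    poly = ℤSolver.solve-∀

  component-+ : ∀ b c d p q r s p′ q′ r′ s′ →
    component b c d (p ℤ.+ p′) (q ℤ.+ q′) (r ℤ.+ r′) (s ℤ.+ s′)
      ≡ component b c d p q r s ℤ.+ component b c d p′ q′ r′ s′
  component-+ = poly
    where
    poly : ∀ b c d p q r s p′ q′ r′ s′ →
      p ℤ.+ p′ ℤ.+ + 2 ℤ.* (b ℤ.* (q ℤ.+ q′) ℤ.+ c ℤ.* (r ℤ.+ r′) ℤ.+ ℤ.- (d ℤ.* (s ℤ.+ s′)))
        ≡ p ℤ.+ + 2 ℤ.* (b ℤ.* q ℤ.+ c ℤ.* r ℤ.+ ℤ.- (d ℤ.* s))
          ℤ.+ (p′ ℤ.+ + 2 ℤ.* (b ℤ.* q′ ℤ.+ c ℤ.* r′ ℤ.+ ℤ.- (d ℤ.* s′)))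
    poly = ℤSolver.solve-∀

  -- All of α except its real part 1 is even, so α acts as the identity mod 2.
  component-odd : ∀ b c d p q r s → component b c d p q r s ≡ p [mod 2 ]
  component-odd b c d p q r s =
    ℤDiv.divides m (poly p m)
    where
    m : ℤ
    m = b ℤ.* q ℤ.+ c ℤ.* r ℤ.+ ℤ.- (d ℤ.* s)
    poly : ∀ p m → p ℤ.+ + 2 ℤ.* m ℤ.- p ≡ m ℤ.* + 2
    poly = ℤSolver.solve-∀

act-scale : ∀ u v → act u (scale v) ≡ scale (act u v)
act-scale (b , c , d) (x ∷ y ∷ z ∷ w ∷ []) = ∷₄-cong
  (component-scale (ℤ.- b) (ℤ.- c) d x y z w) (component-scale b c d y x w z)
  (component-scale c d b z x y w) (component-scale d b c w x z y)

add : Vec ℤ 4 → Vec ℤ 4 → Vec ℤ 4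
add = Vec.zipWith ℤ._+_

act-add : ∀ u v w → act u (add v w) ≡ add (act u v) (act u w)
act-add (b , c , d) (x ∷ y ∷ z ∷ w ∷ []) (x′ ∷ y′ ∷ z′ ∷ w′ ∷ []) = ∷₄-cong
  (component-+ (ℤ.- b) (ℤ.- c) d x y z w x′ y′ z′ w′) (component-+ b c d y x w z y′ x′ w′ z′)
  (component-+ c d b z x y w z′ x′ y′ w′) (component-+ d b c w x z y w′ x′ z′ y′)

-- Divisibility by 5 and the count of norm-5 left factors

Div5 : ∀ {k} → Vec ℤ k → Set
Div5 = VAll.All (+ 5 ℤDiv.∣_)

div5? : ∀ {k} → Decidable (Div5 {k})
div5? = VAll.all? (+ 5 ℤDiv.∣?_)

5∣scale : ∀ {k} (w : Vec ℤ k) → Div5 (scale w)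
5∣scale []      = []
5∣scale (y ∷ w) = ℤDiv.∣m⇒∣m*n y ℤDiv.∣-refl ∷ 5∣scale w

unscale : ∀ {k} {v : Vec ℤ k} → Div5 v → ∃ λ w → v ≡ scale w
unscale []       = [] , refl
unscale (ℤDiv.divides q eq ∷ ds) = let w , eqs = unscale ds in
  q ∷ w , cong₂ _∷_ (trans eq (ℤP.*-comm q (+ 5))) eqs

scale-injective : ∀ {k} {v w : Vec ℤ k} → scale v ≡ scale w → v ≡ w
scale-injective {v = []}    {[]}    _  = refl
scale-injective {v = x ∷ v} {y ∷ w} eq = let p , ps = VP.∷-injective eq in
  cong₂ _∷_ (ℤP.*-cancelˡ-≡ (+ 5) x y p) (scale-injective ps)

div5-shift⁺ : ∀ (v w : Vec ℤ 4) → Div5 v → Div5 (add v (scale w))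
div5-shift⁺ v w d = go v w d
  where
  go : ∀ {k} (v w : Vec ℤ k) → Div5 v → Div5 (Vec.zipWith ℤ._+_ v (scale w))
  go []      []      []       = []
  go (x ∷ v) (y ∷ w) (d ∷ ds) =
    ℤDiv.∣m∣n⇒∣m+n d (ℤDiv.∣m⇒∣m*n y ℤDiv.∣-refl) ∷ go v w ds

div5-shift⁻ : ∀ (v w : Vec ℤ 4) → Div5 (add v (scale w)) → Div5 v
div5-shift⁻ v w d = go v w d
  where
  go : ∀ {k} (v w : Vec ℤ k) → Div5 (Vec.zipWith ℤ._+_ v (scale w)) → Div5 v
  go []      []      []       = []
  go (x ∷ v) (y ∷ w) (d ∷ ds) =
    ℤDiv.∣m+n∣n⇒∣m {m = x} d (ℤDiv.∣m⇒∣m*n y ℤDiv.∣-refl) ∷ go v w ds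

sumOfSquares-shift : ∀ {k} (v w : Vec ℤ k) → ∃ λ t →
  sumOfSquares (Vec.zipWith ℤ._+_ v (scale w)) ≡ sumOfSquares v ℤ.+ t ℤ.* + 5
sumOfSquares-shift []      []      = + 0 , refl
sumOfSquares-shift (x ∷ v) (y ∷ w) = let t , eq = sumOfSquares-shift v w in
  + 2 ℤ.* x ℤ.* y ℤ.+ + 5 ℤ.* y ℤ.* y ℤ.+ t ,
  trans (cong (λ s → (x ℤ.+ + 5 ℤ.* y) ℤ.* (x ℤ.+ + 5 ℤ.* y) ℤ.+ s) eq) (poly x y (sumOfSquares v) t)
  where
  poly : ∀ x y s t → (x ℤ.+ + 5 ℤ.* y) ℤ.* (x ℤ.+ + 5 ℤ.* y) ℤ.+ (s ℤ.+ t ℤ.* + 5)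
    ≡ x ℤ.* x ℤ.+ s ℤ.+ (+ 2 ℤ.* x ℤ.* y ℤ.+ + 5 ℤ.* y ℤ.* y ℤ.+ t) ℤ.* + 5
  poly = ℤSolver.solve-∀

-- These `u` are the ones with v ∈ αℤ⁴: multiplying v = αy by the conjugate of α gives 5y, and
-- conversely. Membership is thus a decidable divisibility.
hits : Vec ℤ 4 → List (Triple ℤ)
hits v = filter (λ u → div5? (act (neg u) v)) units

-- By linearity, changing `v` by a multiple of 5 changes each tested vector by a multiple of 5. This
-- leaves finitely many vectors to inspect.
hits-shift : ∀ v w → hits (add v (scale w)) ≡ hits v
hits-shift v w = LP.filter-≐ (λ u → div5? (act (neg u) (add v (scale w))))
  (λ u → div5? (act (neg u) v))
  ( (λ {u} d → div5-shift⁻ (act (neg u) v) (act (neg u) w) (subst Div5 (linear u) d))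
  , (λ {u} d → subst Div5 (sym (linear u)) (div5-shift⁺ (act (neg u) v) (act (neg u) w) d)))
  units
  where
  linear : ∀ u → act (neg u) (add v (scale w)) ≡ add (act (neg u) v) (scale (act (neg u) w))
  linear u = trans (act-add (neg u) v (scale w)) (cong (add (act (neg u) v)) (act-scale (neg u) w))

fromDigits : (a b c d : ℕ) → Vec ℤ 4
fromDigits a b c d = + a ∷ + b ∷ + c ∷ + d ∷ []

HitsOne : Vec ℤ 4 → Set
HitsOne v = + 5 ℤDiv.∣ sumOfSquares v → length (hits v) ℕ.% 5 ≡ 1

opaque
  unfolding component

  -- Decided by evaluation on all 625 digit vectors, for which `component` has to unfold.
  hits-digits : ∀ {a} → a ℕ.< 5 → ∀ {b} → b ℕ.< 5 → ∀ {c} → c ℕ.< 5 → ∀ {d} → d ℕ.< 5 →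
    HitsOne (fromDigits a b c d)
  hits-digits = toWitness {a? = ℕP.allUpTo? (λ a → ℕP.allUpTo? (λ b → ℕP.allUpTo? (λ c →
    ℕP.allUpTo? (λ d →
      (+ 5 ℤDiv.∣? sumOfSquares (fromDigits a b c d))
        →-dec (length (hits (fromDigits a b c d)) ℕ.% 5 ℕ.≟ 1)) 5) 5) 5) 5} tt

-- Mod 5, a nonzero isotropic vector lies in αℤ⁴ for exactly one of the six α of
-- norm 5, and the zero vector lies in all of them.
hits-one : ∀ v → HitsOne v
hits-one v@(x ∷ y ∷ z ∷ w ∷ []) 5∣v = trans
  (cong (λ l → length l ℕ.% 5) (trans (cong hits v≡) (hits-shift ρ κ)))
  (hits-digits (ℤDM.n%ℕd<d x 5) (ℤDM.n%ℕd<d y 5) (ℤDM.n%ℕd<d z 5) (ℤDM.n%ℕd<d w 5) 5∣ρ)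
  where
  ρ κ : Vec ℤ 4
  ρ = fromDigits (x ℤDM.%ℕ 5) (y ℤDM.%ℕ 5) (z ℤDM.%ℕ 5) (w ℤDM.%ℕ 5)
  κ = (x ℤDM./ℕ 5) ∷ (y ℤDM./ℕ 5) ∷ (z ℤDM./ℕ 5) ∷ (w ℤDM./ℕ 5) ∷ []
  digit : ∀ x → x ≡ + (x ℤDM.%ℕ 5) ℤ.+ + 5 ℤ.* (x ℤDM./ℕ 5)
  digit x = trans (ℤDM.a≡a%ℕn+[a/ℕn]*n x 5)
    (cong (λ t → + (x ℤDM.%ℕ 5) ℤ.+ t) (ℤP.*-comm (x ℤDM./ℕ 5) (+ 5)))
  v≡ : v ≡ add ρ (scale κ)
  v≡ = ∷₄-cong (digit x) (digit y) (digit z) (digit w)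
  5∣ρ : + 5 ℤDiv.∣ sumOfSquares ρ
  5∣ρ = let t , eq = sumOfSquares-shift ρ κ in
    ℤDiv.∣m+n∣n⇒∣m {m = sumOfSquares ρ} {n = t ℤ.* + 5}
      (subst (+ 5 ℤDiv.∣_) (trans (cong sumOfSquares v≡) eq) 5∣v)
      (ℤDiv.∣n⇒∣m*n t ℤDiv.∣-refl)

neg-involutive : ∀ u → neg (neg u) ≡ u
neg-involutive (b , c , d) = cong₂ _,_ (ℤP.neg-involutive b)
  (cong₂ _,_ (ℤP.neg-involutive c) (ℤP.neg-involutive d))

neg-isUnit : ∀ u → IsUnit u → IsUnit (neg u)
neg-isUnit (b , c , d) e = trans (poly b c d) e
  where
  poly : ∀ b c d → ℤ.- b ℤ.* ℤ.- b ℤ.+ ℤ.- c ℤ.* ℤ.- c ℤ.+ ℤ.- d ℤ.* ℤ.- d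
                 ≡ b ℤ.* b ℤ.+ c ℤ.* c ℤ.+ d ℤ.* d
  poly = ℤSolver.solve-∀

act-act-neg : ∀ u → IsUnit u → ∀ v → act u (act (neg u) v) ≡ scale v
act-act-neg u e v = subst (λ u′ → act u′ (act (neg u) v) ≡ scale v) (neg-involutive u)
  (act-neg-act (neg u) (neg-isUnit u e) v)

act-injective : ∀ u → IsUnit u → ∀ {v w} → act u v ≡ act u w → v ≡ w
act-injective u e {v} {w} eq = scale-injective
  (trans (sym (act-neg-act u e v)) (trans (cong (act (neg u)) eq) (act-neg-act u e w)))

act-parity : ∀ u v → VAll.All Odd v ⇔ VAll.All Odd (act u v)
act-parity (b , c , d) (x ∷ y ∷ z ∷ w ∷ []) = mk⇔
  (λ { (ox ∷ oy ∷ oz ∷ ow ∷ []) →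
    up (ℤ.- b) (ℤ.- c) d x y z w ox ∷ up b c d y x w z oy
      ∷ up c d b z x y w oz ∷ up d b c w x z y ow ∷ [] })
  (λ { (ox ∷ oy ∷ oz ∷ ow ∷ []) →
    down (ℤ.- b) (ℤ.- c) d x y z w ox ∷ down b c d y x w z oy
      ∷ down c d b z x y w oz ∷ down d b c w x z y ow ∷ [] })
  where
  up : ∀ b c d p q r s → Odd p → Odd (component b c d p q r s)
  up b c d p q r s odd = subst (+ 2 ℤDiv.∣_) (poly (component b c d p q r s) p)
    (ℤDiv.∣m∣n⇒∣m+n (component-odd b c d p q r s) odd)
    where
    poly : ∀ m p → (m ℤ.- p) ℤ.+ (p ℤ.- + 1) ≡ m ℤ.- + 1
    poly = ℤSolver.solve-∀
  down : ∀ b c d p q r s → Odd (component b c d p q r s) → Odd p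
  down b c d p q r s odd = subst (+ 2 ℤDiv.∣_) (poly (component b c d p q r s) p)
    (ℤDiv.∣m∣n⇒∣m-n odd (component-odd b c d p q r s))
    where
    poly : ∀ m p → (m ℤ.- + 1) ℤ.- (m ℤ.- p) ≡ p ℤ.- + 1
    poly = ℤSolver.solve-∀

norm-index : ∀ n → + (8 ℕ.* (2 ℕ.+ n ℕ.* 5) ℕ.+ 4) ≡ + 5 ℤ.* + (8 ℕ.* n ℕ.+ 4)
norm-index n = trans (cong +_ (poly n)) (ℤP.pos-* 5 (8 ℕ.* n ℕ.+ 4))
  where
  poly : ∀ n → 8 ℕ.* (2 ℕ.+ n ℕ.* 5) ℕ.+ 4 ≡ 5 ℕ.* (8 ℕ.* n ℕ.+ 4)
  poly = ℕSolver.solve-∀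

-- Left multiplication by α is a bijection from the odd representations of 8n + 4 onto the counted
-- ones: it scales the norm by 5, keeps parities, and is inverted by the conjugate followed by
-- division by 5.
length-hit : ∀ n u → IsUnit u →
  length (filter (λ v → div5? (act (neg u) v)) (oddReps 4 (2 ℕ.+ n ℕ.* 5))) ≡ length (oddReps 4 n)
length-hit n u e = trans
  (enum-length
    (enum-filter (λ v → div5? (act (neg u) v)) (enum-oddReps 4 (2 ℕ.+ n ℕ.* 5)))
    (enum-map (act u) (act-injective u e) (enum-oddReps 4 n))
    divide multiply)
  (LP.length-map (act u) (oddReps 4 n))
  where
  divide : ∀ v → OddRep 4 (2 ℕ.+ n ℕ.* 5) v × Div5 (act (neg u) v) →
    ∃ λ w → OddRep 4 n w × v ≡ act u w
  divide v ((sq , odd) , d) = w , (sq′ , from (act-parity u w) (subst (VAll.All Odd) v≡ odd)) , v≡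
    where
    w = proj₁ (unscale d)
    v≡ : v ≡ act u w
    v≡ = scale-injective (trans (sym (act-act-neg u e v))
      (trans (cong (act u) (proj₂ (unscale d))) (act-scale u w)))
    sq′ : sumOfSquares w ≡ + (8 ℕ.* n ℕ.+ 4)
    sq′ = ℤP.*-cancelˡ-≡ (+ 5) _ _ (trans (sym (sumOfSquares-act u e w))
      (trans (cong sumOfSquares (sym v≡)) (trans sq (norm-index n))))
  multiply : ∀ v → (∃ λ w → OddRep 4 n w × v ≡ act u w) →
    OddRep 4 (2 ℕ.+ n ℕ.* 5) v × Div5 (act (neg u) v)
  multiply _ (w , (sq , odd) , refl) =
    ( trans (sumOfSquares-act u e w) (trans (cong (+ 5 ℤ.*_) sq) (sym (norm-index n)))
    , to (act-parity u w) odd)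
    , subst Div5 (sym (act-neg-act u e w)) (5∣scale w)

double-count : ∀ {A B : Set} {P : A → B → Set} (P? : ∀ x y → Dec (P x y)) xs ys →
  sum (map (λ x → length (filter (P? x) ys)) xs)
    ≡ sum (map (λ y → length (filter (λ x → P? x y) xs)) ys)
double-count P? []       ys = sym (sum-zero ys)
  where
  sum-zero : ∀ {B : Set} (ys : List B) → sum (map (λ _ → 0) ys) ≡ 0
  sum-zero []       = refl
  sum-zero (_ ∷ ys) = sum-zero ys
double-count P? (x ∷ xs) ys = trans
  (cong (length (filter (P? x) ys) ℕ.+_) (double-count P? xs ys)) (go ys)
  where
  swap : ∀ a b c → a ℕ.+ (b ℕ.+ c) ≡ b ℕ.+ (a ℕ.+ c)
  swap = ℕSolver.solve-∀
  column : ∀ ys → ℕ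
  column ys = sum (map (λ y → length (filter (λ x → P? x y) xs)) ys)
  go : ∀ ys → length (filter (P? x) ys) ℕ.+ column ys
            ≡ sum (map (λ y → length (filter (λ x → P? x y) (x ∷ xs))) ys)
  go []       = refl
  go (y ∷ ys) with does (P? x y)
  ... | true  = cong suc (trans (swap (length (filter (P? x) ys)) _ (column ys))
                  (cong (length (filter (λ x → P? x y) xs) ℕ.+_) (go ys)))
  ... | false = trans (swap (length (filter (P? x) ys)) _ (column ys))
                  (cong (length (filter (λ x → P? x y) xs) ℕ.+_) (go ys))

sum-const : ∀ {A : Set} {f : A → ℕ} {l xs} → All (λ x → f x ≡ l) xs → sum (map f xs) ≡ length xs ℕ.* l
sum-const []       = refl
sum-const (p ∷ ps) = cong₂ ℕ._+_ p (sum-const ps)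

sum-one : ∀ {A : Set} {f : A → ℕ} {xs} → All (λ x → f x ℕ.% 5 ≡ 1) xs →
  ∃ λ m → sum (map f xs) ≡ length xs ℕ.+ m ℕ.* 5
sum-one []                           = 0 , refl
sum-one {f = f} {x ∷ xs} (p ∷ ps) = let m , eq = sum-one ps in
  f x ℕ./ 5 ℕ.+ m ,
  trans (cong₂ ℕ._+_ (trans (ℕDM.m≡m%n+[m/n]*n (f x) 5) (cong (ℕ._+ f x ℕ./ 5 ℕ.* 5) p)) eq)
    (poly (f x ℕ./ 5) m (length xs))
  where
  poly : ∀ q m l → 1 ℕ.+ q ℕ.* 5 ℕ.+ (l ℕ.+ m ℕ.* 5) ≡ suc l ℕ.+ (q ℕ.+ m) ℕ.* 5
  poly = ℕSolver.solve-∀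

oddReps-4-mod5 : ∀ n → + length (oddReps 4 (2 ℕ.+ n ℕ.* 5)) ≡ + length (oddReps 4 n) [mod 5 ]
-- The quotient comes from `total`: if `length xs` + 5m = 6l, then `length xs` - l = 5(l - m).
oddReps-4-mod5 n = ℤDiv.divides (+ l ℤ.- + m) (solveFor (+ length xs) (+ l) (+ m)
  (trans (cong (λ t → + length xs ℤ.+ t) (sym (ℤP.pos-* m 5)))
    (trans (cong +_ total) (ℤP.pos-* 6 l))))
  where
  xs : List (Vec ℤ 4)
  xs = oddReps 4 (2 ℕ.+ n ℕ.* 5)
  l m : ℕ
  l = length (oddReps 4 n)
  5∣ : ∀ v → OddRep 4 (2 ℕ.+ n ℕ.* 5) v → + 5 ℤDiv.∣ sumOfSquares v
  5∣ v (sq , _) = subst (+ 5 ℤDiv.∣_) (sym (trans sq (norm-index n)))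
    (ℤDiv.∣m⇒∣m*n (+ (8 ℕ.* n ℕ.+ 4)) ℤDiv.∣-refl)
  rows : ∃ λ m → sum (map (λ v → length (hits v)) xs) ≡ length xs ℕ.+ m ℕ.* 5
  rows = sum-one (All.tabulate
    (λ {v} v∈ → hits-one v (5∣ v (to (proj₂ (enum-oddReps 4 (2 ℕ.+ n ℕ.* 5)) v) v∈))))
  m = proj₁ rows
  total : length xs ℕ.+ m ℕ.* 5 ≡ 6 ℕ.* l
  total = trans (sym (proj₂ rows))
    (trans (double-count (λ v u → div5? (act (neg u) v)) xs units)
      (sum-const (All.map (λ {u} e → length-hit n u e) units-isUnit)))
  solveFor : ∀ a l m → a ℤ.+ m ℤ.* + 5 ≡ + 6 ℤ.* l → a ℤ.- l ≡ (l ℤ.- m) ℤ.* + 5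
  solveFor a l m eq = trans (poly₁ a l m) (trans (cong (λ t → t ℤ.- l ℤ.- m ℤ.* + 5) eq) (poly₂ l m))
    where
    poly₁ : ∀ a l m → a ℤ.- l ≡ a ℤ.+ m ℤ.* + 5 ℤ.- l ℤ.- m ℤ.* + 5
    poly₁ = ℤSolver.solve-∀
    poly₂ : ∀ l m → + 6 ℤ.* l ℤ.- l ℤ.- m ℤ.* + 5 ≡ (l ℤ.- m) ℤ.* + 5
    poly₂ = ℤSolver.solve-∀

-- Partitions with distinct odd parts

BoundedPOD : ℕ → ℕ → List ℕ → Set
BoundedPOD m n ps = IsPODPartition n ps × All (_≤ m) ps

boundedPODs : ℕ → ℕ → List (List ℕ)
boundedPODs m n = filter (All.all? (ℕ._≤? m)) (podPartitions n)

boundedPod : ℕ → ℕ → ℕ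
boundedPod m n = length (boundedPODs m n)

enum-podPartitions : ∀ n → Enumerates (IsPODPartition n) (podPartitions n)
enum-podPartitions n = podPartitions-unique n , ∈-podPartitions n

enum-boundedPODs : ∀ m n → Enumerates (BoundedPOD m n) (boundedPODs m n)
enum-boundedPODs m n = enum-filter (All.all? (ℕ._≤? m)) (enum-podPartitions n)

parts≤sum : ∀ {m} ps → sum ps ≤ m → All (_≤ m) ps
parts≤sum []       _  = []
parts≤sum (p ∷ ps) le = ℕP.≤-trans (ℕP.m≤m+n p (sum ps)) le
  ∷ parts≤sum ps (ℕP.≤-trans (ℕP.m≤n+m (sum ps) p) le)

boundedPod-pod : ∀ {m n} → n ≤ m → boundedPod m n ≡ pod n
boundedPod-pod {m} {n} n≤m = enum-length (enum-boundedPODs m n) (enum-podPartitions n)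
  (λ _ → proj₁)
  (λ ps pod → pod , parts≤sum ps (subst (_≤ m) (sym (proj₂ (proj₂ (proj₁ pod)))) n≤m))

boundedPod-zero : ∀ n → boundedPod 0 (suc n) ≡ 0
boundedPod-zero n = enum-length (enum-boundedPODs 0 (suc n)) ([] , λ _ → mk⇔ (λ ()) (λ ()))
  none (λ _ ())
  where
  none : ∀ ps → BoundedPOD 0 (suc n) ps → ⊥
  none []       ((( _ , _ , ()) , _) , _)
  none (_ ∷ _) ((((s≤s _ ∷ _) , _) , _) , (() ∷ _))

-- `m′` bounds the parts that may follow a largest part `suc m`: it is `suc m` when that part is
-- even and may recur, and `m` when it is odd.
Step : ℕ → ℕ → Set
Step m m′ = ∀ qs → (Unique (oddParts (suc m ∷ qs)) × All (_≤ suc m) qs)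
                 ⇔ (Unique (oddParts qs) × All (_≤ m′) qs)

even-step : ∀ {m} → 2 ∣ suc m → Step m (suc m)
even-step {m} 2∣ qs = mk⇔ (λ (u , b) → subst Unique reject u , b)
                          (λ (u , b) → subst Unique (sym reject) u , b)
  where
  reject : oddParts (suc m ∷ qs) ≡ oddParts qs
  reject = LP.filter-reject (λ p → ¬? (2 ∣? p)) (λ ¬2∣ → ¬2∣ 2∣)

odd-step : ∀ {m} → ¬ 2 ∣ suc m → Step m m
odd-step {m} ¬2∣ qs = mk⇔ forth back
  where
  accept : oddParts (suc m ∷ qs) ≡ suc m ∷ oddParts qs
  accept = LP.filter-accept (λ p → ¬? (2 ∣? p)) ¬2∣
  forth : Unique (oddParts (suc m ∷ qs)) × All (_≤ suc m) qs → Unique (oddParts qs) × All (_≤ m) qs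
  forth (u , b) with subst Unique accept u
  -- A further part equal to `suc m` would be a repeated odd part, so the bound drops by one.
  ... | fresh ∷ u′ = u′ , All.tabulate (λ {q} q∈ →
    ℕ.s≤s⁻¹ (ℕP.≤∧≢⇒< (All.lookup b q∈) λ { refl →
      All.lookup fresh (∈-filter⁺ (λ p → ¬? (2 ∣? p)) q∈ ¬2∣) refl }))
  back : Unique (oddParts qs) × All (_≤ m) qs → Unique (oddParts (suc m ∷ qs)) × All (_≤ suc m) qs
  back (u , b) = subst Unique (sym accept) (All.tabulate fresh ∷ u) , All.map ℕP.m≤n⇒m≤1+n b
    where
    open import Data.List.Membership.Propositional.Properties using (∈-filter⁻)
    fresh : ∀ {q} → q ∈ oddParts qs → suc m ≢ q
    fresh q∈ refl = ℕP.1+n≰n (All.lookup b (proj₁ (∈-filter⁻ (λ p → ¬? (2 ∣? p)) {xs = qs} q∈)))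

≥-trans : ∀ {a b c} → a ≥ b → b ≥ c → a ≥ c
≥-trans p q = ℕP.≤-trans q p

-- Parts are non-increasing, so the head decides: if it is `suc m` it is removed, and otherwise
-- every part is at most `m`.
boundedPod-step : ∀ {m m′} → Step m m′ → ∀ k →
  boundedPod (suc m) (suc m ℕ.+ k) ≡ boundedPod m (suc m ℕ.+ k) ℕ.+ boundedPod m′ k
boundedPod-step {m} {m′} step k = trans
  (enum-length (enum-boundedPODs (suc m) (suc m ℕ.+ k))
    (enum-++ (enum-boundedPODs m (suc m ℕ.+ k))
      (enum-map (suc m ∷_) (λ { refl → refl }) (enum-boundedPODs m′ k)) disjoint)
    split join)
  (trans (LP.length-++ (boundedPODs m (suc m ℕ.+ k)))
    (cong (boundedPod m (suc m ℕ.+ k) ℕ.+_) (LP.length-map (suc m ∷_) (boundedPODs m′ k))))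
  where
  Shifted : List ℕ → Set
  Shifted ps = ∃ λ qs → BoundedPOD m′ k qs × ps ≡ suc m ∷ qs

  disjoint : ∀ ps → BoundedPOD m (suc m ℕ.+ k) ps → Shifted ps → ⊥
  disjoint _ (_ , le ∷ _) (_ , _ , refl) = ℕP.1+n≰n le

  split : ∀ ps → BoundedPOD (suc m) (suc m ℕ.+ k) ps → BoundedPOD m (suc m ℕ.+ k) ps ⊎ Shifted ps
  split [] (((_ , _ , ()) , _) , _)
  split (q ∷ qs) (((pos ∷ poss , linked , total) , uniq) , le ∷ les) with q ℕ.≟ suc m
                                                                      | Linked⇒AllPairs ≥-trans linked
  ... | yes refl | desc ∷ descs =
    let u , b = to (step qs) (uniq , les) in
    inj₂ (qs , (((poss , AllPairs⇒Linked descs , ℕP.+-cancelˡ-≡ (suc m) (sum qs) k total) , u) , b) , refl)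
  ... | no q≢ | desc ∷ _ =
    let q≤m = ℕ.s≤s⁻¹ (ℕP.≤∧≢⇒< le q≢) in
    inj₁ (((pos ∷ poss , linked , total) , uniq) , q≤m ∷ All.map (λ x≤q → ℕP.≤-trans x≤q q≤m) desc)

  join : ∀ ps → BoundedPOD m (suc m ℕ.+ k) ps ⊎ Shifted ps → BoundedPOD (suc m) (suc m ℕ.+ k) ps
  join ps (inj₁ (pod , b)) = pod , All.map ℕP.m≤n⇒m≤1+n b
  join _ (inj₂ (qs , (((poss , linked , total) , u) , b) , refl)) =
    let u′ , b′ = from (step qs) (u , b) in
    (((s≤s z≤n ∷ poss) , AllPairs⇒Linked (b′ ∷ Linked⇒AllPairs ≥-trans linked)
      , cong (suc m ℕ.+_) total) , u′) , ℕP.≤-refl ∷ b′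

open import Data.Nat using (_+_; _*_)

-- Gauss's identity from the finite form

module Gauss {c ℓ} (R : CommutativeRing c ℓ) where

  open CommutativeRing R using (_≈_; 0#)
  private module R = CommutativeRing R
  open PowerSeries R
  private module S = CommutativeRing seriesRing
  open Sums seriesRing

  -- For coefficient `n`, `A` may be replaced by `H (2 * n)` and `ψ` by its first 2n + 1 terms, to
  -- which `shanks` applies. The two recurrences of `H` are 1 - X^(2j+1) as a numerator and 1 -
  -- X^(2j+2) as a denominator, written without subtraction or inverse.
  gauss : (H : ℕ → Series) (A ψ : Series) → H 0 ≋ 𝟙 →
    (∀ j → H (suc (2 * j)) ⊕ X ^ˢ suc (2 * j) ∗ H (2 * j) ≋ H (2 * j)) →
    (∀ j → H (suc (suc (2 * j))) ≋ H (suc (2 * j)) ⊕ X ^ˢ suc (suc (2 * j)) ∗ H (suc (suc (2 * j)))) →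
    (∀ {m n} → n ℕ.≤ m → A n ≈ H m n) →
    (∀ {k n} → n ℕ.< k → ψ n ≈ triSum X k n) →
    A ∗ ψ ≋ 𝟙
  gauss H A ψ H0 Hodd Heven A≈H ψ≈tri n = begin
    (A ∗ ψ) n
      ≈⟨ ∗-cong-≤ n (λ i≤n → A≈H (ℕP.≤-trans i≤n n≤2n)) (λ i≤n → ψ≈tri (s≤s (ℕP.≤-trans i≤n n≤2n))) ⟩
    (h n ∗ triSum X (suc (2 * n))) n
      ≈⟨ Shanks.shanks seriesRing X h h-rec X^-cancel n n ⟩
    powerSum h (X ^ˢ suc (2 * n)) n n   ≈⟨ low n ⟩
    h 0 n                               ≈⟨ H0 n ⟩
    𝟙 n                                 ∎
    where
    open SetoidReasoning R.setoid
    n≤2n : n ℕ.≤ 2 * n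
    n≤2n = ℕP.m≤m+n n (n + 0)
    h : ℕ → Series
    h j = H (2 * j)
    double : ∀ j → 2 * suc j ≡ suc (suc (2 * j))
    double = ℕP.*-suc 2
    h-rec : ∀ j → h (suc j) ⊕ h j ∗ X ^ˢ suc (2 * j) ≋ h j ⊕ h (suc j) ∗ X ^ˢ suc (suc (2 * j))
    h-rec j rewrite double j = SR.begin
      H″ ⊕ H° ∗ p                 SR.≈⟨ S.+-cong (Heven j) (S.*-comm H° p) ⟩
      H′ ⊕ p′ ∗ H″ ⊕ p ∗ H°       SR.≈⟨ S.+-assoc H′ (p′ ∗ H″) (p ∗ H°) ⟩
      H′ ⊕ (p′ ∗ H″ ⊕ p ∗ H°)     SR.≈⟨ S.+-congˡ (S.+-comm (p′ ∗ H″) (p ∗ H°)) ⟩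
      H′ ⊕ (p ∗ H° ⊕ p′ ∗ H″)     SR.≈⟨ S.+-assoc H′ (p ∗ H°) (p′ ∗ H″) ⟨
      H′ ⊕ p ∗ H° ⊕ p′ ∗ H″       SR.≈⟨ S.+-cong (Hodd j) (S.*-comm p′ H″) ⟩
      H° ⊕ H″ ∗ p′                SR.∎
      where
      module SR = SetoidReasoning S.setoid
      H° H′ H″ p p′ : Series
      H° = H (2 * j)
      H′ = H (suc (2 * j))
      H″ = H (suc (suc (2 * j)))
      p  = X ^ˢ suc (2 * j)
      p′ = X ^ˢ suc (suc (2 * j))
    -- All terms past the first are multiples of X^(2n+1), so they do not reach coefficient `n`.
    low : ∀ m → powerSum h (X ^ˢ suc (2 * n)) m n ≈ h 0 n
    low zero    = R.refl
    low (suc m) = R.trans (R.+-cong (low m) vanish) (R.+-identityʳ _)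
      where
      z : Series
      z = X ^ˢ suc (2 * n)
      vanish : (h (suc m) ∗ (z ∗ z ^ˢ m)) n ≈ 0#
      vanish = R.trans (S.*-comm (h (suc m)) (z ∗ z ^ˢ m) n)
        (R.trans (S.*-assoc z (z ^ˢ m) (h (suc m)) n)
          (X^-∗-< (suc (2 * n)) (z ^ˢ m ∗ h (suc m)) (s≤s n≤2n)))

-- The signed partition series modulo 5

ℤ/5 : CommutativeRing _ _
ℤ/5 = ℤ-mod 5

module Z = CommutativeRing ℤ/5
open PowerSeries ℤ/5
open Sums seriesRing using (triSum)

ψ : Series
ψ n = + length (triRoots n (suc n))

-- Each new summand X^(`tri k`) adds 1 to coefficient `n` exactly when `k` joins the list of roots.
triSum-coeff : ∀ k n → triSum X k n Z.≈ + length (triRoots n k)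
triSum-coeff zero    n = Z.refl
triSum-coeff (suc k) n = step (tri k ℕ.≟ n)
  where
  l : ℕ
  l = length (triRoots n k)
  step : Dec (tri k ≡ n) → triSum X k n ℤ.+ (X ^ˢ tri k) n Z.≈ + length (triRoots n (suc k))
  step (yes eq) = Z.trans
    (Z.+-cong (triSum-coeff k n) (subst (λ t → (X ^ˢ tri k) t Z.≈ + 1) eq (X^-≡ (tri k))))
    (≡⇒≈ (cong +_ (≡.trans (ℕP.+-comm l 1)
      (≡.sym (cong length (LP.filter-accept (λ s → tri s ℕ.≟ n) {x = k} {xs = downFrom k} eq))))))
  step (no k≢n) = Z.trans (Z.+-cong (triSum-coeff k n) (X^-≢ (tri k) k≢n))
    (≡⇒≈ (cong +_ (≡.trans (ℕP.+-identityʳ l)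
      (≡.sym (cong length (LP.filter-reject (λ s → tri s ℕ.≟ n) {x = k} {xs = downFrom k} k≢n))))))

ψ≈triSum : ∀ {k n} → n ℕ.< k → ψ n Z.≈ triSum X k n
ψ≈triSum {k} {n} n<k = Z.trans
  (≡⇒≈ (cong +_ (enum-length (enum-triRoots (ℕP.n<1+n n)) (enum-triRoots n<k)
    (λ _ p → p) (λ _ p → p))))
  (Z.sym (triSum-coeff k n))

sign : ℕ → ℤ
sign n = -1ℤ ℤ.^ n

sign-+ : ∀ m n → sign (m + n) ≡ sign m ℤ.* sign n
sign-+ m n = ℤP.^-distribˡ-+-* -1ℤ m n

sign-even : ∀ j → sign (2 * j) ≡ + 1
sign-even j = ≡.trans (≡.sym (ℤP.^-*-assoc -1ℤ 2 j)) (ℤP.^-zeroˡ j)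

signedBounded : ℕ → Series
signedBounded m n = sign n ℤ.* + boundedPod m n

signedPod : Series
signedPod n = sign n ℤ.* + pod n

signedPod≡signedBounded : ∀ {m n} → n ℕ.≤ m → signedPod n ≡ signedBounded m n
signedPod≡signedBounded {m} {n} n≤m = cong (λ t → sign n ℤ.* + t) (≡.sym (boundedPod-pod n≤m))

signedBounded-step-< : ∀ {m n} → n ℕ.< suc m → signedBounded (suc m) n ≡ signedBounded m n
signedBounded-step-< n<k = ≡.trans (≡.sym (signedPod≡signedBounded (ℕP.<⇒≤ n<k)))
  (signedPod≡signedBounded (ℕ.s≤s⁻¹ n<k))

-- The sign is multiplicative in the size, so a removed part contributes its own sign: -1 if odd, +1
-- if even. Only the factors for odd parts change under q ↦ -q.
signedBounded-step-≥ : ∀ {m m′} → Step m m′ → ∀ k →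
  signedBounded (suc m) (suc m + k) ≡ signedBounded m (suc m + k) ℤ.+ sign (suc m) ℤ.* signedBounded m′ k
signedBounded-step-≥ {m} {m′} step k = begin
  sign (suc m + k) ℤ.* + boundedPod (suc m) (suc m + k)
    ≡⟨ cong (λ t → sign (suc m + k) ℤ.* + t) (boundedPod-step step k) ⟩
  sign (suc m + k) ℤ.* + (boundedPod m (suc m + k) + boundedPod m′ k)
    ≡⟨ ℤP.*-distribˡ-+ (sign (suc m + k)) (+ boundedPod m (suc m + k)) (+ boundedPod m′ k) ⟩
  signedBounded m (suc m + k) ℤ.+ sign (suc m + k) ℤ.* + boundedPod m′ k
    ≡⟨ cong (λ s → signedBounded m (suc m + k) ℤ.+ s ℤ.* + boundedPod m′ k) (sign-+ (suc m) k) ⟩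
  signedBounded m (suc m + k) ℤ.+ sign (suc m) ℤ.* sign k ℤ.* + boundedPod m′ k
    ≡⟨ cong (λ t → signedBounded m (suc m + k) ℤ.+ t)
         (ℤP.*-assoc (sign (suc m)) (sign k) (+ boundedPod m′ k)) ⟩
  signedBounded m (suc m + k) ℤ.+ sign (suc m) ℤ.* signedBounded m′ k ∎
  where open ≡.≡-Reasoning

index-split : ∀ {P : ℕ → Set} k → (∀ {n} → n ℕ.< k → P n) → (∀ i → P (k + i)) → ∀ n → P n
index-split {P} k small large n with n ℕ.<? k
... | yes n<k = small n<k
... | no  n≮k = subst P (ℕP.m+[n∸m]≡n (ℕP.≮⇒≥ n≮k)) (large (n ℕ.∸ k))

2∤odd : ∀ j → ¬ 2 ∣ suc (2 * j)
2∤odd j p = toWitnessFalse {a? = 2 ℕDiv.∣? 1} tt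
  (ℕDiv.∣m+n∣m⇒∣n (subst (2 ∣_) (ℕP.+-comm 1 (2 * j)) p) (ℕDiv.m∣m*n j))

2∣even : ∀ j → 2 ∣ suc (suc (2 * j))
2∣even j = subst (2 ∣_) (ℕP.*-suc 2 j) (ℕDiv.m∣m*n (suc j))

signedBounded-odd : ∀ j →
  signedBounded (suc (2 * j)) ⊕ X ^ˢ suc (2 * j) ∗ signedBounded (2 * j) ≋ signedBounded (2 * j)
signedBounded-odd j = index-split (suc m)
  (λ {n} n<k → Z.trans (Z.+-cong (≡⇒≈ (signedBounded-step-< n<k)) (X^-∗-< (suc m) (signedBounded m) n<k))
    (Z.+-identityʳ (signedBounded m n)))
  (λ i → Z.trans (Z.+-cong (≡⇒≈ (≡.trans (signedBounded-step-≥ (odd-step (2∤odd j)) i)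
      (cong (λ s → signedBounded m (suc m + i) ℤ.+ -1ℤ ℤ.* s ℤ.* signedBounded m i) (sign-even j))))
      (X^-∗-+ (suc m) (signedBounded m) i))
    (≡⇒≈ (cancel (signedBounded m (suc m + i)) (signedBounded m i))))
  where
  m : ℕ
  m = 2 * j
  cancel : ∀ a b → a ℤ.+ -1ℤ ℤ.* + 1 ℤ.* b ℤ.+ b ≡ a
  cancel = ℤSolver.solve-∀

-- The same series occurs on both sides because an even part may recur; this encodes the geometric
-- factor 1 / (1 - X^(2j+2)).
signedBounded-even : ∀ j → signedBounded (suc (suc (2 * j))) ≋
  signedBounded (suc (2 * j)) ⊕ X ^ˢ suc (suc (2 * j)) ∗ signedBounded (suc (suc (2 * j)))
signedBounded-even j = index-split (suc m)
  (λ {n} n<k → Z.trans (≡⇒≈ (signedBounded-step-< n<k)) (Z.sym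
    (Z.trans (Z.+-congˡ {signedBounded m n} (X^-∗-< (suc m) (signedBounded (suc m)) n<k))
      (Z.+-identityʳ (signedBounded m n)))))
  (λ i → Z.trans (≡⇒≈ (≡.trans (signedBounded-step-≥ (even-step (2∣even j)) i)
      (≡.trans (cong (λ s → signedBounded m (suc m + i) ℤ.+ -1ℤ ℤ.* (-1ℤ ℤ.* s) ℤ.* signedBounded (suc m) i)
          (sign-even j))
        (simplify (signedBounded m (suc m + i)) (signedBounded (suc m) i)))))
    (Z.+-congˡ {signedBounded m (suc m + i)} (Z.sym (X^-∗-+ (suc m) (signedBounded (suc m)) i))))
  where
  m : ℕ
  m = suc (2 * j)
  simplify : ∀ a b → a ℤ.+ -1ℤ ℤ.* (-1ℤ ℤ.* + 1) ℤ.* b ≡ a ℤ.+ b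
  simplify = ℤSolver.solve-∀

signedBounded-zero : signedBounded 0 ≋ 𝟙
signedBounded-zero zero    = Z.refl
signedBounded-zero (suc n) = ≡⇒≈ (≡.trans (cong (λ t → sign (suc n) ℤ.* + t) (boundedPod-zero n))
  (ℤP.*-zeroʳ (sign (suc n))))

signedPod∗ψ : signedPod ∗ ψ ≋ 𝟙
signedPod∗ψ = Gauss.gauss ℤ/5 signedBounded signedPod ψ
  signedBounded-zero signedBounded-odd signedBounded-even
  (λ n≤m → ≡⇒≈ (signedPod≡signedBounded n≤m)) ψ≈triSum

module S = CommutativeRing seriesRing
open Series5 ℤ/5 (mod (ℤDiv.divides (+ 1) ≡.refl)) using (two; sect-inverse)
open import Algebra.Properties.CommutativeSemiring.Exp Z.commutativeSemiring using (_^_; ^-congˡ)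

signedPod∗Θ : signedPod ∗ Θ 5 ≋ two
signedPod∗Θ = S.trans (S.*-congˡ {signedPod} Θ≋ψ⊕ψ)
  (S.trans (S.distribˡ signedPod ψ ψ) (S.+-cong signedPod∗ψ signedPod∗ψ))
  where
  Θ≋ψ⊕ψ : Θ 5 ≋ ψ ⊕ ψ
  Θ≋ψ⊕ψ n = ≡⇒≈ (cong +_ (length-oddRoots n))

-- The coefficient condition of `frobenius`. Both sides depend on `x` only mod 5, so five cases
-- suffice.
fermat : ∀ x → x ^ 5 Z.≈ x
fermat x = Z.trans (^-congˡ 5 x≈r) (Z.trans (mod (digits (ℤDM.n%ℕd<d x 5))) (Z.sym x≈r))
  where
  digits : ∀ {a} → a ℕ.< 5 → + 5 ℤDiv.∣ ((+ a) ^ 5 ℤ.- + a)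
  digits = toWitness {a? = ℕP.allUpTo? (λ a → + 5 ℤDiv.∣? ((+ a) ^ 5 ℤ.- + a)) 5} tt
  x≈r : x Z.≈ + (x ℤDM.%ℕ 5)
  x≈r = mod (ℤDiv.divides (x ℤDM./ℕ 5) (≡.trans
    (cong (ℤ._- + (x ℤDM.%ℕ 5)) (ℤDM.a≡a%ℕn+[a/ℕn]*n x 5))
    (poly (+ (x ℤDM.%ℕ 5)) ((x ℤDM./ℕ 5) ℤ.* + 5))))
    where
    poly : ∀ a b → a ℤ.+ b ℤ.- a ≡ b
    poly = ℤSolver.solve-∀

sect-Θ⁴ : sect (Θ 5 ^ˢ 4) ≋ Θ 5 ^ˢ 4
sect-Θ⁴ n = Z.trans (Z.sym (Θ^-coeff 5 4 (2 + n * 5)))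
  (Z.trans (mod (oddReps-4-mod5 n)) (Θ^-coeff 5 4 n))

theorem3 : (n : ℕ) →
    + pod (5 * n + 2) ≡ + 2 ℤ.* (-1ℤ ℤ.^ n) ℤ.* + r 3 (8 * n + 3) [mod 5 ]
theorem3 n = unmod (begin
  + pod (5 * n + 2)                              ≈⟨ ≡⇒≈ (cong (λ k → + pod k) (index n)) ⟩
  -- A square of the sign is inserted: one copy turns `pod` into the coefficient of `signedPod`, the
  -- other survives as the sign in the result.
  + pod (2 + n * 5)                              ≈⟨ ≡⇒≈ (ℤP.*-identityˡ (+ pod (2 + n * 5))) ⟨
  + 1 ℤ.* + pod (2 + n * 5)                      ≈⟨ ≡⇒≈ (cong (ℤ._* + pod (2 + n * 5)) sign²) ⟨
  sign n ℤ.* sign n ℤ.* + pod (2 + n * 5)        ≈⟨ ≡⇒≈ (ℤP.*-assoc (sign n) (sign n) (+ pod (2 + n * 5))) ⟩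
  sign n ℤ.* (sign n ℤ.* + pod (2 + n * 5))
    ≈⟨ ≡⇒≈ (cong (λ s → sign n ℤ.* (s ℤ.* + pod (2 + n * 5))) sign-index) ⟨
  sign n ℤ.* sect signedPod n
    ≈⟨ Z.*-congˡ {sign n} (sect-inverse signedPod (Θ 5) signedPod∗Θ (λ n → fermat (Θ 5 n)) sect-Θ⁴ n) ⟩
  sign n ℤ.* (two ∗ Θ 5 ^ˢ 3) n
    ≈⟨ Z.*-congˡ {sign n} (S.trans (S.distribʳ (Θ 5 ^ˢ 3) 𝟙 𝟙)
         (S.+-cong (S.*-identityˡ (Θ 5 ^ˢ 3)) (S.*-identityˡ (Θ 5 ^ˢ 3))) n) ⟩
  sign n ℤ.* ((Θ 5 ^ˢ 3) n ℤ.+ (Θ 5 ^ˢ 3) n)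
    ≈⟨ Z.*-congˡ {sign n} (Z.+-cong (Θ^-coeff 5 3 n) (Θ^-coeff 5 3 n)) ⟨
  sign n ℤ.* (+ length (oddReps 3 n) ℤ.+ + length (oddReps 3 n))
    ≈⟨ ≡⇒≈ (cong (λ t → sign n ℤ.* (+ t ℤ.+ + t)) (r3-oddReps n)) ⟨
  sign n ℤ.* (+ r 3 (8 * n + 3) ℤ.+ + r 3 (8 * n + 3))
    ≈⟨ ≡⇒≈ (poly (sign n) (+ r 3 (8 * n + 3))) ⟩
  + 2 ℤ.* sign n ℤ.* + r 3 (8 * n + 3)           ∎)
  where
  open SetoidReasoning Z.setoid
  index : ∀ n → 5 * n + 2 ≡ 2 + n * 5
  index = ℕSolver.solve-∀
  poly : ∀ s t → s ℤ.* (t ℤ.+ t) ≡ + 2 ℤ.* s ℤ.* t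
  poly = ℤSolver.solve-∀
  sign² : sign n ℤ.* sign n ≡ + 1
  sign² = ≡.trans (≡.sym (sign-+ n n))
    (≡.trans (cong (λ k → sign (n + k)) (≡.sym (ℕP.+-identityʳ n))) (sign-even n))
  -- The sign of 5n is that of n because (-1)⁵ evaluates to -1.
  sign-index : sign (2 + n * 5) ≡ sign n
  sign-index = ≡.trans (sign-+ 2 (n * 5)) (≡.trans (ℤP.*-identityˡ (sign (n * 5)))
    (≡.trans (cong sign (ℕP.*-comm n 5)) (≡.sym (ℤP.^-*-assoc -1ℤ 5 n))))
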